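{- Let $p$ be an odd prime and $r\geq 1$ an integer, and let $G$ be an extraspecial group of order $p^{2r+1}$ and exponent $p^2$. Then there exists a semiregular relative difference set in $G$ with parameters $(p^{2r},p,p^{2r},p^{2r-1})$.
   Context: For a finite group $G$ and $X\subseteq G$, write $\underline{X}=\sum_{x\in X}x\in\mathbb{Z}G$ and $X^{(-1)}=\{x^{ -1}:x\in X\}$; $e$ is the identity. For a subgroup $N\leq G$ (not necessarily normal), a subset $X\subseteq G$ is a relative difference set (RDS) relative to $N$ with parameters $(m,n,k,\lambda)$ if $\underline{X}\cdot\underline{X^{(-1)}}=ke+\lambda(\underline{G}-\underline{N})$, where $k=|X|$, $m=|G:N|$, $n=|N|$, and $\lambda$ is a positive integer. It is semiregular if $|X\cap Ng|=1$ for all $g\in G$. -}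

module Defs where

open import Data.Nat using (ℕ; zero; suc; _*_; _^_; _∸_; _+_; _<_)
open import Data.Fin using (Fin; _≟_)
open import Data.Fin.Properties using (all?; any?)
open import Data.Fin.Subset using (Subset; _∈_; ∣_∣)
open import Data.Fin.Subset.Properties using (_∈?_)
open import Data.List using (List; length; filter; allFin; cartesianProduct)
open import Data.Product using (_×_; _,_; Σ; ∃)
open import Relation.Binary.PropositionalEquality using (_≡_)
open import Relation.Nullary using (Dec; ¬_; yes; no)
open import Relation.Nullary.Decidable using (_×-dec_)

-- A finite group, with carrier Fin order (every finite group is isomorphic
-- to one of this form).
record FinGroup : Set where
  field
    order : ℕ
    _·_   : Fin order → Fin order → Fin order
    e     : Fin order
    inv   : Fin order → Fin order
    assoc     : ∀ x y z → (x · y) · z ≡ x · (y · z)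
    identityˡ : ∀ x → e · x ≡ x
    identityʳ : ∀ x → x · e ≡ x
    inverseˡ  : ∀ x → inv x · x ≡ e
    inverseʳ  : ∀ x → x · inv x ≡ e

module _ (G : FinGroup) where
  open FinGroup G

  El : Set
  El = Fin order

  pow : El → ℕ → El
  pow g zero    = e
  pow g (suc k) = g · pow g k

  comm : El → El → El
  comm x y = ((inv x · inv y) · x) · y

  IsCentral : El → Set
  IsCentral z = ∀ g → z · g ≡ g · z

  isCentral? : ∀ z → Dec (IsCentral z)
  isCentral? z = all? (λ g → (z · g) ≟ (g · z))

  centerSize : ℕ
  centerSize = length (filter isCentral? (allFin order))

  -- Extraspecial (Wikipedia's definition): Z(G) is cyclic of order p
  -- (equivalently, for p prime, of order p) and G/Z(G) is a non-trivial
  -- elementary abelian p-group; G/Z(G) abelian means all commutators are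
  -- central, exponent p means all p-th powers are central; non-triviality is
  -- automatic here since |G| = p^(2r+1) with r ≥ 1.
  IsExtraspecialOfOrder : ℕ → ℕ → Set
  IsExtraspecialOfOrder p r =
    (order ≡ p ^ (2 * r + 1)) ×
    (centerSize ≡ p) ×
    (∀ x y → IsCentral (comm x y)) ×
    (∀ x → IsCentral (pow x p))

  HasExponentSq : ℕ → Set
  HasExponentSq p = (∀ g → pow g (p * p) ≡ e) × (∃ λ g → ¬ (pow g p ≡ e))

  IsSubgroup : Subset order → Set
  IsSubgroup N = (e ∈ N) × (∀ x y → x ∈ N → y ∈ N → (x · y) ∈ N)
                 × (∀ x → x ∈ N → inv x ∈ N)

  -- coefficient of g in  X · X^(-1)  in ℤG :  #{(x , y) ∈ X × X | x y⁻¹ = g}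
  prodCoeff : Subset order → El → ℕ
  prodCoeff X g = length (filter (λ { (x , y) → (x ∈? X) ×-dec ((y ∈? X) ×-dec ((x · inv y) ≟ g)) })
                                 (cartesianProduct (allFin order) (allFin order)))

  δ : El → El → ℕ
  δ a b with a ≟ b
  ... | yes _ = 1
  ... | no  _ = 0

  notIn : El → Subset order → ℕ
  notIn g N with g ∈? N
  ... | yes _ = 0
  ... | no  _ = 1

  -- X is an RDS relative to the subgroup N with parameters (m, n, k, λ):
  --   X X^(-1) = k e + λ (G - N)   in ℤG, compared coefficientwise,
  -- with k = |X|, m = |G : N| (i.e. |N| * m = |G|), n = |N|, λ positive.
  IsRDS : Subset order → Subset order → ℕ → ℕ → ℕ → ℕ → Set
  IsRDS X N m n k lam =
    IsSubgroup N × (∣ N ∣ * m ≡ order) × (∣ N ∣ ≡ n) × (∣ X ∣ ≡ k) ×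
    (0 < lam) ×
    (∀ g → prodCoeff X g ≡ k * δ g e + lam * notIn g N)

  cosetMeet : Subset order → Subset order → El → ℕ
  cosetMeet X N g =
    length (filter (λ x → (x ∈? X) ×-dec any? (λ h → (h ∈? N) ×-dec (x ≟ (h · g))))
                   (allFin order))

  IsSemiregular : Subset order → Subset order → Set
  IsSemiregular X N = ∀ g → cosetMeet X N g ≡ 1

{-# OPTIONS --safe #-}
module Submission where

open import Defs
open import Algebra.Bundles using (Group; AbelianGroup)
open import Algebra.Structures using (IsAbelianGroup)
import Algebra.Properties.AbelianGroup as AbelianGroupProperties
import Algebra.Properties.CommutativeMonoid.Mult as CommutativeMult
import Algebra.Properties.Group as GroupProperties
import Algebra.Properties.Monoid.Mult as Mult
import Algebra.Solver.CommutativeMonoid as CommutativeMonoidSolver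
open import Data.Fin using (Fin; zero; suc; toℕ; fromℕ<; _≟_)
open import Data.Fin.Permutation using (Permutation′; permutation; _⟨$⟩ʳ_)
open import Data.Fin.Properties using (any?; suc-injective; toℕ-fromℕ<; toℕ-injective; toℕ<n)
open import Data.Fin.Subset using (Subset; _∈_; ∣_∣; inside; outside)
open import Data.Fin.Subset.Properties using (_∈?_; drop-there)
open import Data.List using (List; []; _∷_; _++_; allFin; cartesianProduct; filter; length; map; tabulate)
open import Data.List.Membership.Propositional using () renaming (_∈_ to _∈ₗ_)
open import Data.List.Membership.Propositional.Properties using (∈-allFin)
open import Data.List.Properties using (filter-++; length-++; map-tabulate)
open import Data.List.Relation.Unary.Any using (here; there)
open import Data.Nat using (ℕ; zero; suc; pred; _+_; _*_; _^_; _∸_; _/_; _%_; _≤_; _<_; z≤n; s≤s; z<s; NonZero; >-nonZero)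
open import Data.Nat.Coprimality using (Coprime; coprime-Bézout; prime⇒coprime)
open import Data.Nat.DivMod using (m≡m%n+[m/n]*n; m%n<n)
open import Data.Nat.Divisibility using (_∣_; _∣?_; divides; m%n≡0⇒n∣m)
open import Data.Nat.GCD using (module Bézout)
open import Data.Nat.Primality using (Prime; prime⇒irreducible; prime⇒nonZero)
open import Data.Nat.Properties
  using (+-0-commutativeMonoid; +-cancelʳ-≤; +-cancelˡ-≤; +-comm; +-mono-≤; +-monoʳ-≤; *-cancelˡ-≡; *-comm; *-identityʳ; m+[n∸m]≡n; m∸n≤m; ∸-monoʳ-<; m<n⇒0<n∸m; m*n≢0; m^n>0; suc-pred; <-cmp; <⇒≤; ≤-<-trans; ≤-antisym; ≤-reflexive; ≤-trans)
open import Data.Nat.Solver using (module +-*-Solver)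
open import Data.Product using (_×_; _,_; Σ; ∃; proj₁; proj₂)
open import Data.Sum using (_⊎_; inj₁; inj₂) renaming (map to map-⊎)
open import Data.Unit using (⊤; tt)
import Data.Vec as Vec
open import Data.Vec.Properties using (lookup∘tabulate; lookup⇒[]=; []=⇒lookup)
open import Function using (_∘_)
open import Level using (Level; 0ℓ)
open import Relation.Binary.Definitions using (tri<; tri≈; tri>)
open import Relation.Binary.PropositionalEquality
  using (_≡_; _≢_; refl; sym; trans; cong; cong₂; subst; isEquivalence; module ≡-Reasoning)
open import Relation.Nullary using (Dec; ¬_; ¬?; yes; no; does; contradiction)
open import Relation.Nullary.Decidable using (_×-dec_; dec-true; decidable-stable; map′)
open import Relation.Unary using (Pred; Decidable)
open import Algebra.Properties.CommutativeMonoid.Sum +-0-commutativeMonoid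
  using (sum; sum-cong-≗; sum-permute; ∑-comm)

-- Take N = Z(G).  Since p is odd, the Baer sum x ⊕ y = x y [y,x]^((p+1)/2) makes G an abelian group with the
-- same centre, inverses and powers, and g x = (g ⊕ x) ⊖ β(g,x) for the bilinear map β(g,x) = [x,g]^((p+1)/2).
-- Let L be a subgroup of (G,⊕) maximal with L ∩ Z(G) trivial, so that L ⊕ Z(G) = { w : w^p = e }, and let a be
-- an element of order p².  Then X = { k ⊖ i a : k ∈ L, 0 ≤ i < p } meets every coset of the centre once; let
-- φ(x) be the central element with x ⊕ φ(x) ∈ X.  The set X ∩ g⁻¹X consists of the x ∈ X for which
-- D(x) = φ(g x) ⊖ φ(x) vanishes.  If g is not central, then D takes all central values equally often, because
-- some translation x ↦ x ⊕ b adds the constant β(g,b) ≠ e to D: if g does not centralise L, then a suitable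
-- b ∈ L works since φ is L-invariant; if g centralises L, then g ∈ L ⊕ Z(G), hence D(x) = β(g,x) ⊕ const, and
-- every b not commuting with g works.

private variable
  a b : Level
  A B : Set a
  n m : ℕ

-- Counting in finite types by sums of indicators.

indicator : Dec A → ℕ
indicator (yes _) = 1
indicator (no _)  = 0

indicator-⇔ : (A? : Dec A) (B? : Dec B) → (A → B) → (B → A) → indicator A? ≡ indicator B?
indicator-⇔ (yes _) (yes _) f g = refl
indicator-⇔ (yes x) (no ¬y) f g = contradiction (f x) ¬y
indicator-⇔ (no ¬x) (yes y) f g = contradiction (g y) ¬x
indicator-⇔ (no _)  (no _)  f g = refl

# : {P : Pred (Fin n) a} → Decidable P → ℕ
# P? = sum (indicator ∘ P?)

#-cong : {P : Pred (Fin n) a} {Q : Pred (Fin n) b} (P? : Decidable P) (Q? : Decidable Q) →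
         (∀ x → P x → Q x) → (∀ x → Q x → P x) → # P? ≡ # Q?
#-cong P? Q? f g = sum-cong-≗ λ x → indicator-⇔ (P? x) (Q? x) (f x) (g x)

#-none : {P : Pred (Fin n) a} (P? : Decidable P) → (∀ x → ¬ P x) → # P? ≡ 0
#-none {n = zero}  P? ¬P = refl
#-none {n = suc n} P? ¬P with P? zero
... | yes P0 = contradiction P0 (¬P zero)
... | no  _  = #-none (P? ∘ suc) (¬P ∘ suc)

#-unique : {P : Pred (Fin n) a} (P? : Decidable P) (x : Fin n) →
           P x → (∀ y → P y → y ≡ x) → # P? ≡ 1
#-unique P? zero Px unique with P? zero
... | yes _  = cong suc (#-none (P? ∘ suc) λ y Py → contradiction (unique (suc y) Py) λ ())
... | no ¬P0 = contradiction Px ¬P0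
#-unique P? (suc x) Px unique with P? zero
... | yes P0 = contradiction (unique zero P0) λ ()
... | no _   = #-unique (P? ∘ suc) x Px λ y Py → suc-injective (unique (suc y) Py)

#-permute : {P : Pred (Fin n) a} (P? : Decidable P) (π : Permutation′ n) →
            # P? ≡ # (P? ∘ (π ⟨$⟩ʳ_))
#-permute P? π = sum-permute (indicator ∘ P?) π

sum-const : (f : Fin m → ℕ) (k : ℕ) → (∀ j → f j ≡ k) → sum f ≡ m * k
sum-const {m = zero}  f k f≡k = refl
sum-const {m = suc m} f k f≡k = cong₂ _+_ (f≡k zero) (sum-const (f ∘ suc) k (f≡k ∘ suc))

sum-mono-≤ : (f g : Fin n → ℕ) → (∀ x → f x ≤ g x) → sum f ≤ sum g
sum-mono-≤ {n = zero}  f g f≤g = z≤n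
sum-mono-≤ {n = suc n} f g f≤g = +-mono-≤ (f≤g zero) (sum-mono-≤ (f ∘ suc) (g ∘ suc) (f≤g ∘ suc))

-- A deficit in one term could not be made up by the others. This turns an equality of two totals
-- into an equality for each element.
sum-tight : (f g : Fin n → ℕ) → (∀ x → f x ≤ g x) → sum g ≤ sum f → ∀ x → f x ≡ g x
sum-tight {n = suc n} f g f≤g Σg≤Σf = λ where
    zero    → f0≡g0
    (suc x) → sum-tight (f ∘ suc) (g ∘ suc) (f≤g ∘ suc)
                (+-cancelˡ-≤ (g zero) _ _ (subst (λ k → sum g ≤ k + sum (f ∘ suc)) f0≡g0 Σg≤Σf)) x
  where
  f0≡g0 : f zero ≡ g zero
  f0≡g0 = ≤-antisym (f≤g zero) (+-cancelʳ-≤ (sum (f ∘ suc)) _ _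
    (≤-trans (+-monoʳ-≤ (g zero) (sum-mono-≤ (f ∘ suc) (g ∘ suc) (f≤g ∘ suc))) Σg≤Σf))

#-partition : {P : Pred (Fin n) a} {Q : Fin m → Pred (Fin n) b}
              (P? : Decidable P) (Q? : ∀ j → Decidable (Q j)) →
              (∀ j x → Q j x → P x) → (∀ x → P x → ∃ λ j → Q j x) →
              (∀ i j x → Q i x → Q j x → i ≡ j) →
              # P? ≡ sum (λ j → # (Q? j))
#-partition {P = P} {Q} P? Q? Q⇒P P⇒Q disjoint =
  -- Each `x` satisfying `P` is counted for exactly one `j` and every other `x` for none, so
  -- exchanging the two sums gives the claim.
  trans (sum-cong-≗ classify) (∑-comm λ x j → indicator (Q? j x))
  where
  classify : ∀ x → indicator (P? x) ≡ # (λ j → Q? j x)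
  classify x with P? x
  ... | no ¬Px = sym (#-none _ λ j Qjx → ¬Px (Q⇒P j x Qjx))
  ... | yes Px with P⇒Q x Px
  ...   | j , Qjx = sym (#-unique _ j Qjx λ i Qix → disjoint i j x Qix Qjx)

-- With the next lemma and `∣∣≡#`, this converts the list and subset counts of the definitions into
-- sums, where the order of summation can be exchanged.
length-filter-tabulate : {P : Pred A b} (P? : Decidable P) (f : Fin n → A) →
                         length (filter P? (tabulate f)) ≡ # (P? ∘ f)
length-filter-tabulate {n = zero}  P? f = refl
length-filter-tabulate {n = suc n} P? f with P? (f zero)
... | yes _ = cong suc (length-filter-tabulate P? (f ∘ suc))
... | no _  = length-filter-tabulate P? (f ∘ suc)

length-filter-cartesianProduct :
  {C : Set b} {P : Pred (A × C) a} (P? : Decidable P) (f : Fin m → A) (g : Fin n → C) →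
  length (filter P? (cartesianProduct (tabulate f) (tabulate g))) ≡ sum (λ i → # λ j → P? (f i , g j))
length-filter-cartesianProduct {m = zero}  P? f g = refl
length-filter-cartesianProduct {m = suc m} P? f g = begin
  length (filter P? (row ++ rest))                 ≡⟨ cong length (filter-++ P? row rest) ⟩
  length (filter P? row ++ filter P? rest)         ≡⟨ length-++ (filter P? row) ⟩
  length (filter P? row) + length (filter P? rest) ≡⟨ cong₂ _+_ row-length (length-filter-cartesianProduct P? (f ∘ suc) g) ⟩
  _                                                ∎
  where
  open ≡-Reasoning
  row = map (f zero ,_) (tabulate g)
  rest = cartesianProduct (tabulate (f ∘ suc)) (tabulate g)
  row-length : length (filter P? row) ≡ # (λ j → P? (f zero , g j))
  row-length = trans (cong (length ∘ filter P?) (map-tabulate g (f zero ,_)))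
                     (length-filter-tabulate P? ((f zero ,_) ∘ g))

∣∣≡# : (X : Subset n) → ∣ X ∣ ≡ # (_∈? X)
∣∣≡# Vec.[]            = refl
∣∣≡# (inside Vec.∷ X)  = cong suc (trans (∣∣≡# X) (#-cong (_∈? X) (λ i → suc i ∈? inside Vec.∷ X) (λ _ → Vec.there) (λ _ → drop-there)))
∣∣≡# (outside Vec.∷ X) = trans (∣∣≡# X) (#-cong (_∈? X) (λ i → suc i ∈? outside Vec.∷ X) (λ _ → Vec.there) (λ _ → drop-there))

subset : {P : Pred (Fin n) a} → Decidable P → Subset n
subset P? = Vec.tabulate (does ∘ P?)

∈-subset⁺ : {P : Pred (Fin n) a} (P? : Decidable P) {x : Fin n} → P x → x ∈ subset P?
∈-subset⁺ P? {x} Px = lookup⇒[]= x _ (trans (lookup∘tabulate _ x) (dec-true (P? x) Px))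

∈-subset⁻ : {P : Pred (Fin n) a} (P? : Decidable P) {x : Fin n} → x ∈ subset P? → P x
∈-subset⁻ P? {x} x∈ with P? x | trans (sym (lookup∘tabulate (does ∘ P?) x)) ([]=⇒lookup x∈)
... | yes Px | _ = Px
... | no _   | ()

∣subset∣ : {P : Pred (Fin n) a} (P? : Decidable P) → ∣ subset P? ∣ ≡ # P?
∣subset∣ P? = trans (∣∣≡# (subset P?)) (#-cong (_∈? subset P?) P? (λ _ → ∈-subset⁻ P?) (λ _ → ∈-subset⁺ P?))

-- Multiples, powers and the centre.

module _ {c ℓ h : Level} (𝒢 : Group c ℓ) where
  open Group 𝒢 hiding (sym)
  open Mult monoid using () renaming (_×_ to _⋆_)

  -- Bézout coefficients write `w` as a difference of multiples of `m ⋆ w` and `n ⋆ w`. The subgroup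
  -- `H` is left general because it is used both for the trivial subgroup of `G` and for the sum of
  -- `L` and the centre in the Baer group.
  coprime-multiples : (H : Carrier → Set h) → (∀ {x y} → x ≈ y → H x → H y) →
                      H ε → (∀ {x y} → H x → H y → H (x ∙ y)) → (∀ {x} → H x → H (x ⁻¹)) →
                      ∀ {m n} → Coprime m n → ∀ w → H (m ⋆ w) → H (n ⋆ w) → H w
  coprime-multiples H H-resp Hε H-∙ H-⁻¹ {m} {n} m⊥n w Hm Hn = by-Bézout (coprime-Bézout m⊥n)
    where
    multiple : ∀ k {u} → H u → H (k ⋆ u)
    multiple zero    Hu = Hε
    multiple (suc k) Hu = H-∙ Hu (multiple k Hu)

    difference : ∀ {i j} x y → 1 + y * j ≡ x * i → H (i ⋆ w) → H (j ⋆ w) → H w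
    difference {i} {j} x y eq Hi Hj = H-resp (GroupProperties.//-rightDividesʳ 𝒢 ((y * j) ⋆ w) w)
      (H-∙ (subst (λ k → H (k ⋆ w)) (sym eq) (H-resp (Mult.×-assocˡ monoid w x i) (multiple x Hi)))
           (H-⁻¹ (H-resp (Mult.×-assocˡ monoid w y j) (multiple y Hj))))

    by-Bézout : Bézout.Identity 1 m n → H w
    by-Bézout (Bézout.+- x y eq) = difference x y eq Hm Hn
    by-Bézout (Bézout.-+ x y eq) = difference y x eq Hn Hm

module Powers (G : FinGroup) where
  open FinGroup G

  group : Group 0ℓ 0ℓ
  group = record
    { Carrier = El G ; _≈_ = _≡_ ; _∙_ = _·_ ; ε = e ; _⁻¹ = inv
    ; isGroup = record
      { isMonoid = record
        { isSemigroup = record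
          { isMagma = record { isEquivalence = isEquivalence ; ∙-cong = cong₂ _·_ }
          ; assoc = assoc }
        ; identity = identityˡ , identityʳ }
      ; inverse = inverseˡ , inverseʳ
      ; ⁻¹-cong = cong inv } }

  open Group group using (monoid)
  open Mult monoid using (×-homo-+; ×-assocˡ) renaming (_×_ to _⋆_)

  pow≡⋆ : ∀ x n → pow G x n ≡ n ⋆ x
  pow≡⋆ x zero    = refl
  pow≡⋆ x (suc n) = cong (x ·_) (pow≡⋆ x n)

  pow-+ : ∀ x m n → pow G x (m + n) ≡ pow G x m · pow G x n
  pow-+ x m n = begin
    pow G x (m + n)       ≡⟨ pow≡⋆ x (m + n) ⟩
    (m + n) ⋆ x           ≡⟨ ×-homo-+ x m n ⟩
    (m ⋆ x) · (n ⋆ x)     ≡⟨ cong₂ _·_ (pow≡⋆ x m) (pow≡⋆ x n) ⟨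
    pow G x m · pow G x n ∎
    where open ≡-Reasoning

  pow-* : ∀ x m n → pow G (pow G x n) m ≡ pow G x (m * n)
  pow-* x m n = begin
    pow G (pow G x n) m ≡⟨ pow≡⋆ (pow G x n) m ⟩
    m ⋆ pow G x n       ≡⟨ cong (m ⋆_) (pow≡⋆ x n) ⟩
    m ⋆ (n ⋆ x)         ≡⟨ ×-assocˡ x m n ⟩
    (m * n) ⋆ x         ≡⟨ pow≡⋆ x (m * n) ⟨
    pow G x (m * n)     ∎
    where open ≡-Reasoning

  pow-e : ∀ n → pow G e n ≡ e
  pow-e zero    = refl
  pow-e (suc n) = trans (identityˡ _) (pow-e n)

module Centre (G : FinGroup) where
  open FinGroup G
  open Powers G
  open GroupProperties group using (∙-cancelˡ)
  open ≡-Reasoning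

  central-e : IsCentral G e
  central-e g = trans (identityˡ g) (sym (identityʳ g))

  central-· : ∀ {x y} → IsCentral G x → IsCentral G y → IsCentral G (x · y)
  central-· {x} {y} zx zy g = begin
    (x · y) · g ≡⟨ assoc x y g ⟩
    x · (y · g) ≡⟨ cong (x ·_) (zy g) ⟩
    x · (g · y) ≡⟨ assoc x g y ⟨
    (x · g) · y ≡⟨ cong (_· y) (zx g) ⟩
    (g · x) · y ≡⟨ assoc g x y ⟩
    g · (x · y) ∎

  central-inv : ∀ {x} → IsCentral G x → IsCentral G (inv x)
  central-inv {x} zx g = ∙-cancelˡ x _ _ (begin
    x · (inv x · g) ≡⟨ assoc x (inv x) g ⟨
    (x · inv x) · g ≡⟨ cong (_· g) (inverseʳ x) ⟩
    e · g           ≡⟨ central-e g ⟩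
    g · e           ≡⟨ cong (g ·_) (inverseʳ x) ⟨
    g · (x · inv x) ≡⟨ assoc g x (inv x) ⟨
    (g · x) · inv x ≡⟨ cong (_· inv x) (zx g) ⟨
    (x · g) · inv x ≡⟨ assoc x g (inv x) ⟩
    x · (g · inv x) ∎)

  central-pow : ∀ {x} → IsCentral G x → ∀ n → IsCentral G (pow G x n)
  central-pow zx zero    = central-e
  central-pow zx (suc n) = central-· zx (central-pow zx n)

  slide : ∀ {z} → IsCentral G z → ∀ x y → (x · z) · y ≡ (x · y) · z
  slide {z} zz x y = begin
    (x · z) · y ≡⟨ assoc x z y ⟩
    x · (z · y) ≡⟨ cong (x ·_) (zz y) ⟩
    x · (y · z) ≡⟨ assoc x y z ⟨
    (x · y) · z ∎

  pow-· : ∀ {y} → IsCentral G y → ∀ x n → pow G (x · y) n ≡ pow G x n · pow G y n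
  pow-· zy x zero = sym (identityˡ e)
  pow-· {y} zy x (suc n) = begin
    (x · y) · pow G (x · y) n              ≡⟨ cong ((x · y) ·_) (pow-· zy x n) ⟩
    (x · y) · (pow G x n · pow G y n)      ≡⟨ assoc (x · y) _ _ ⟨
    ((x · y) · pow G x n) · pow G y n      ≡⟨ cong (_· pow G y n) (slide zy x _) ⟩
    ((x · pow G x n) · y) · pow G y n      ≡⟨ assoc _ y _ ⟩
    (x · pow G x n) · (y · pow G y n)      ∎

-- The Baer sum of a group with central commutators.

record BaerSum (G : FinGroup) : Set where
  open FinGroup G
  infixl 7 _⊕_
  field
    _⊕_            : El G → El G → El G
    isAbelianGroup : IsAbelianGroup _≡_ _⊕_ e inv
    β              : El G → El G → El G
    β-central      : ∀ x y → IsCentral G (β x y)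
    β-⊕ʳ           : ∀ x y y′ → β x (y ⊕ y′) ≡ β x y ⊕ β x y′
    commute⇒β≡e    : ∀ {x y} → y · x ≡ x · y → β x y ≡ e
    β≡e⇒commute    : ∀ {x y} → β x y ≡ e → x · y ≡ y · x
    ·≡⊕            : ∀ x y → x · y ≡ (x ⊕ y) ⊕ inv (β x y)

  abelianGroup : AbelianGroup 0ℓ 0ℓ
  abelianGroup = record { isAbelianGroup = isAbelianGroup }

  open AbelianGroup abelianGroup public
    using () renaming (comm to ⊕-comm; assoc to ⊕-assoc; identityˡ to ⊕-identityˡ; identityʳ to ⊕-identityʳ; inverseʳ to ⊕-inverseʳ)
  open CommutativeMult (AbelianGroup.commutativeMonoid abelianGroup) public
    using () renaming (_×_ to _⋆_; ×-homo-+ to ⋆-+; ×-assocˡ to ⋆-*; ×-distrib-+ to ⋆-⊕)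

  β-centralʳ : ∀ {z} → IsCentral G z → ∀ x → β x z ≡ e
  β-centralʳ zz x = commute⇒β≡e (zz x)

  commute⇒·≡⊕ : ∀ {x y} → y · x ≡ x · y → x · y ≡ x ⊕ y
  commute⇒·≡⊕ {x} {y} eq = begin
    x · y                   ≡⟨ ·≡⊕ x y ⟩
    x ⊕ y ⊕ inv (β x y)     ≡⟨ cong (λ u → x ⊕ y ⊕ inv u) (commute⇒β≡e eq) ⟩
    x ⊕ y ⊕ inv e           ≡⟨ cong (x ⊕ y ⊕_) (GroupProperties.ε⁻¹≈ε (Powers.group G)) ⟩
    x ⊕ y ⊕ e               ≡⟨ ⊕-identityʳ _ ⟩
    x ⊕ y                   ∎
    where open ≡-Reasoning

  ⊕-centralʳ : ∀ {z} → IsCentral G z → ∀ x → x ⊕ z ≡ x · z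
  ⊕-centralʳ zz x = sym (commute⇒·≡⊕ (zz x))

  -- An element commutes with its own powers, and on commuting elements the two operations agree.
  pow≡multiple : ∀ x n → pow G x n ≡ n ⋆ x
  pow≡multiple x zero    = refl
  pow≡multiple x (suc n) = trans (commute⇒·≡⊕ (xⁿ·x≡x·xⁿ n)) (cong (x ⊕_) (pow≡multiple x n))
    where
    xⁿ·x≡x·xⁿ : ∀ n → pow G x n · x ≡ x · pow G x n
    xⁿ·x≡x·xⁿ zero    = Centre.central-e G x
    xⁿ·x≡x·xⁿ (suc n) = trans (assoc x _ x) (cong (x ·_) (xⁿ·x≡x·xⁿ n))

-- By `half`, the h-th power is a square root on commutators. It stands in for the exponent 1/2, and
-- for odd p it is available with h = (p + 1) / 2.
module Baer (G : FinGroup) (comm-central : ∀ x y → IsCentral G (comm G x y))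
            (h : ℕ) (half : ∀ x y → pow G (comm G x y) (h + h) ≡ comm G x y) where
  open FinGroup G
  open Powers G
  open Centre G
  open GroupProperties group using (∙-cancelˡ)
  open ≡-Reasoning

  κ : El G → El G → El G
  κ = comm G

  swap : ∀ x y → x · y ≡ (y · x) · κ x y
  swap x y = sym (begin
    (y · x) · (((inv x · inv y) · x) · y) ≡⟨ assoc _ _ y ⟨
    ((y · x) · ((inv x · inv y) · x)) · y ≡⟨ cong (_· y) (assoc _ _ x) ⟨
    (((y · x) · (inv x · inv y)) · x) · y ≡⟨ cong (λ u → (u · x) · y) cancel ⟩
    (e · x) · y                           ≡⟨ cong (_· y) (identityˡ x) ⟩
    x · y                                 ∎)
    where
    cancel : (y · x) · (inv x · inv y) ≡ e
    cancel = begin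
      (y · x) · (inv x · inv y) ≡⟨ assoc _ _ (inv y) ⟨
      ((y · x) · inv x) · inv y ≡⟨ cong (_· inv y) (assoc y x (inv x)) ⟩
      (y · (x · inv x)) · inv y ≡⟨ cong (λ u → (y · u) · inv y) (inverseʳ x) ⟩
      (y · e) · inv y           ≡⟨ cong (_· inv y) (identityʳ y) ⟩
      y · inv y                 ≡⟨ inverseʳ y ⟩
      e                         ∎

  -- Identities between commutators thereby reduce to moving one factor past another and reading off
  -- what is left on the right.
  κ-unique : ∀ x y {c} → x · y ≡ (y · x) · c → κ x y ≡ c
  κ-unique x y eq = ∙-cancelˡ (y · x) _ _ (trans (sym (swap x y)) eq)

  commute⇒κ≡e : ∀ {x y} → x · y ≡ y · x → κ x y ≡ e
  commute⇒κ≡e eq = κ-unique _ _ (trans eq (sym (identityʳ _)))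

  -- Moving `y` to the left past `x′` and then past `x` releases one commutator each time; both are
  -- central, so they collect on the right.
  κ-·ˡ : ∀ x x′ y → κ (x · x′) y ≡ κ x y · κ x′ y
  κ-·ˡ x x′ y = κ-unique _ y (begin
    (x · x′) · y                          ≡⟨ assoc x x′ y ⟩
    x · (x′ · y)                          ≡⟨ cong (x ·_) (swap x′ y) ⟩
    x · ((y · x′) · κ x′ y)               ≡⟨ assoc x _ _ ⟨
    (x · (y · x′)) · κ x′ y               ≡⟨ cong (_· κ x′ y) (assoc x y x′) ⟨
    ((x · y) · x′) · κ x′ y               ≡⟨ cong (λ u → (u · x′) · κ x′ y) (swap x y) ⟩
    (((y · x) · κ x y) · x′) · κ x′ y     ≡⟨ cong (_· κ x′ y) (slide (comm-central x y) _ x′) ⟩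
    (((y · x) · x′) · κ x y) · κ x′ y     ≡⟨ assoc _ _ _ ⟩
    ((y · x) · x′) · (κ x y · κ x′ y)     ≡⟨ cong (_· (κ x y · κ x′ y)) (assoc y x x′) ⟩
    (y · (x · x′)) · (κ x y · κ x′ y)     ∎)

  κ-inverse : ∀ x y → κ x y · κ y x ≡ e
  κ-inverse x y = ∙-cancelˡ (y · x) _ _ (begin
    (y · x) · (κ x y · κ y x) ≡⟨ assoc _ _ _ ⟨
    ((y · x) · κ x y) · κ y x ≡⟨ cong (_· κ y x) (swap x y) ⟨
    (x · y) · κ y x           ≡⟨ swap y x ⟨
    y · x                     ≡⟨ identityʳ _ ⟨
    (y · x) · e               ∎)

  κ-·ʳ : ∀ x y y′ → κ x (y · y′) ≡ κ x y · κ x y′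
  κ-·ʳ x y y′ = κ-unique x _ (begin
    x · (y · y′)                          ≡⟨ assoc x y y′ ⟨
    (x · y) · y′                          ≡⟨ cong (_· y′) (swap x y) ⟩
    ((y · x) · κ x y) · y′                ≡⟨ slide (comm-central x y) _ y′ ⟩
    ((y · x) · y′) · κ x y                ≡⟨ cong (_· κ x y) (assoc y x y′) ⟩
    (y · (x · y′)) · κ x y                ≡⟨ cong (λ u → (y · u) · κ x y) (swap x y′) ⟩
    (y · ((y′ · x) · κ x y′)) · κ x y     ≡⟨ cong (_· κ x y) (assoc y _ _) ⟨
    ((y · (y′ · x)) · κ x y′) · κ x y     ≡⟨ slide (comm-central x y′) _ _ ⟩
    ((y · (y′ · x)) · κ x y) · κ x y′     ≡⟨ assoc _ _ _ ⟩
    (y · (y′ · x)) · (κ x y · κ x y′)     ≡⟨ cong (_· (κ x y · κ x y′)) (assoc y y′ x) ⟨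
    ((y · y′) · x) · (κ x y · κ x y′)     ∎)

  -- Half of the factor that turns x · y into y · x, whence the reversed order in `κ y x`.
  -- Multiplying x · y by it gives the midpoint of x · y and y · x, which is symmetric.
  β : El G → El G → El G
  β x y = pow G (κ y x) h

  β-central : ∀ x y → IsCentral G (β x y)
  β-central x y = central-pow (comm-central y x) h

  β-·ˡ : ∀ x x′ y → β (x · x′) y ≡ β x y · β x′ y
  β-·ˡ x x′ y = trans (cong (λ u → pow G u h) (κ-·ʳ y x x′)) (pow-· (comm-central y x′) _ h)

  β-·ʳ : ∀ x y y′ → β x (y · y′) ≡ β x y · β x y′
  β-·ʳ x y y′ = trans (cong (λ u → pow G u h) (κ-·ˡ y y′ x)) (pow-· (comm-central y′ x) _ h)

  commute⇒β≡e : ∀ {x y} → y · x ≡ x · y → β x y ≡ e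
  commute⇒β≡e eq = trans (cong (λ u → pow G u h) (commute⇒κ≡e eq)) (pow-e h)

  β-centralˡ : ∀ {z} → IsCentral G z → ∀ y → β z y ≡ e
  β-centralˡ zz y = commute⇒β≡e (sym (zz y))

  β-centralʳ : ∀ {z} → IsCentral G z → ∀ x → β x z ≡ e
  β-centralʳ zz x = commute⇒β≡e (zz x)

  κ≡β² : ∀ x y → κ y x ≡ β x y · β x y
  κ≡β² x y = trans (sym (half y x)) (pow-+ (κ y x) h h)

  β-inverse : ∀ x y → β x y · β y x ≡ e
  β-inverse x y = begin
    β x y · β y x                 ≡⟨ pow-· (comm-central x y) _ h ⟨
    pow G (κ y x · κ x y) h       ≡⟨ cong (λ u → pow G u h) (κ-inverse y x) ⟩
    pow G e h                     ≡⟨ pow-e h ⟩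
    e                             ∎

  -- Halving loses nothing: `κ y x` is recovered as the square of `β x y`.
  β≡e⇒commute : ∀ {x y} → β x y ≡ e → x · y ≡ y · x
  β≡e⇒commute {x} {y} eq = sym (begin
    y · x                       ≡⟨ swap y x ⟩
    (x · y) · κ y x             ≡⟨ cong ((x · y) ·_) (κ≡β² x y) ⟩
    (x · y) · (β x y · β x y)   ≡⟨ cong₂ (λ u v → (x · y) · (u · v)) eq eq ⟩
    (x · y) · (e · e)           ≡⟨ cong ((x · y) ·_) (identityˡ e) ⟩
    (x · y) · e                 ≡⟨ identityʳ _ ⟩
    x · y                       ∎)

  infixl 7 _⊕_
  _⊕_ : El G → El G → El G
  x ⊕ y = (x · y) · β x y

  ⊕-comm : ∀ x y → x ⊕ y ≡ y ⊕ x
  ⊕-comm x y = sym (begin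
    (y · x) · β y x                       ≡⟨ cong (_· β y x) (swap y x) ⟩
    ((x · y) · κ y x) · β y x             ≡⟨ cong (λ u → ((x · y) · u) · β y x) (κ≡β² x y) ⟩
    ((x · y) · (β x y · β x y)) · β y x   ≡⟨ assoc _ _ _ ⟩
    (x · y) · ((β x y · β x y) · β y x)   ≡⟨ cong ((x · y) ·_) (assoc _ _ _) ⟩
    (x · y) · (β x y · (β x y · β y x))   ≡⟨ cong (λ u → (x · y) · (β x y · u)) (β-inverse x y) ⟩
    (x · y) · (β x y · e)                 ≡⟨ cong ((x · y) ·_) (identityʳ _) ⟩
    (x · y) · β x y                       ∎)

  ⊕-centralʳ : ∀ {z} → IsCentral G z → ∀ x → x ⊕ z ≡ x · z
  ⊕-centralʳ zz x = trans (cong (_ ·_) (β-centralʳ zz x)) (identityʳ _)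

  β-⊕ˡ : ∀ x x′ y → β (x ⊕ x′) y ≡ β x y · β x′ y
  β-⊕ˡ x x′ y = begin
    β ((x · x′) · β x x′) y    ≡⟨ β-·ˡ _ _ y ⟩
    β (x · x′) y · β (β x x′) y ≡⟨ cong (β (x · x′) y ·_) (β-centralˡ (β-central x x′) y) ⟩
    β (x · x′) y · e           ≡⟨ identityʳ _ ⟩
    β (x · x′) y               ≡⟨ β-·ˡ x x′ y ⟩
    β x y · β x′ y             ∎

  β-⊕ʳ : ∀ x y y′ → β x (y ⊕ y′) ≡ β x y ⊕ β x y′
  β-⊕ʳ x y y′ = begin
    β x ((y · y′) · β y y′)     ≡⟨ β-·ʳ x _ _ ⟩
    β x (y · y′) · β x (β y y′) ≡⟨ cong (β x (y · y′) ·_) (β-centralʳ (β-central y y′) x) ⟩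
    β x (y · y′) · e            ≡⟨ identityʳ _ ⟩
    β x (y · y′)                ≡⟨ β-·ʳ x y y′ ⟩
    β x y · β x y′              ≡⟨ ⊕-centralʳ (β-central x y′) _ ⟨
    β x y ⊕ β x y′              ∎

  -- By bilinearity of `β`, both sides are the product of `x`, `y`, `z` in `G` times the central
  -- factors `β x y`, `β x z` and `β y z`.
  ⊕-assoc : ∀ x y z → (x ⊕ y) ⊕ z ≡ x ⊕ (y ⊕ z)
  ⊕-assoc x y z = begin
    (((x · y) · β x y) · z) · β (x ⊕ y) z          ≡⟨ cong₂ _·_ (slide (β-central x y) _ z) (β-⊕ˡ x y z) ⟩
    (((x · y) · z) · β x y) · (β x z · β y z)      ≡⟨ cong (λ u → (u · β x y) · (β x z · β y z)) (assoc x y z) ⟩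
    ((x · (y · z)) · β x y) · (β x z · β y z)      ≡⟨ assoc _ _ _ ⟨
    (((x · (y · z)) · β x y) · β x z) · β y z      ≡⟨ slide (β-central x z) _ _ ⟩
    (((x · (y · z)) · β x y) · β y z) · β x z      ≡⟨ cong (_· β x z) (slide (β-central x y) _ _) ⟩
    (((x · (y · z)) · β y z) · β x y) · β x z      ≡⟨ assoc _ _ _ ⟩
    ((x · (y · z)) · β y z) · (β x y · β x z)      ≡⟨ cong₂ _·_ (assoc x _ _) (sym (trans (β-⊕ʳ x y z) (⊕-centralʳ (β-central x z) _))) ⟩
    (x · ((y · z) · β y z)) · β x (y ⊕ z)          ∎

  ⊕-identityʳ : ∀ x → x ⊕ e ≡ x
  ⊕-identityʳ x = trans (⊕-centralʳ central-e x) (identityʳ x)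

  ⊕-inverseʳ : ∀ x → x ⊕ inv x ≡ e
  ⊕-inverseʳ x = begin
    (x · inv x) · β x (inv x) ≡⟨ cong₂ _·_ (inverseʳ x) (commute⇒β≡e (trans (inverseˡ x) (sym (inverseʳ x)))) ⟩
    e · e                     ≡⟨ identityˡ e ⟩
    e                         ∎

  ·≡⊕ : ∀ x y → x · y ≡ (x ⊕ y) ⊕ inv (β x y)
  ·≡⊕ x y = begin
    x · y                             ≡⟨ identityʳ _ ⟨
    (x · y) · e                       ≡⟨ cong (_ ·_) (inverseʳ (β x y)) ⟨
    (x · y) · (β x y · inv (β x y))   ≡⟨ assoc _ _ _ ⟨
    (x ⊕ y) · inv (β x y)             ≡⟨ ⊕-centralʳ (central-inv (β-central x y)) _ ⟨
    (x ⊕ y) ⊕ inv (β x y)             ∎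

  baerSum : BaerSum G
  baerSum = record
    { _⊕_ = _⊕_
    ; isAbelianGroup = record
      { isGroup = record
        { isMonoid = record
          { isSemigroup = record
            { isMagma = record { isEquivalence = isEquivalence ; ∙-cong = cong₂ _⊕_ }
            ; assoc = ⊕-assoc }
          ; identity = (λ x → trans (⊕-comm e x) (⊕-identityʳ x)) , ⊕-identityʳ }
        ; inverse = (λ x → trans (⊕-comm (inv x) x) (⊕-inverseʳ x)) , ⊕-inverseʳ
        ; ⁻¹-cong = cong inv }
      ; comm = ⊕-comm }
    ; β = β ; β-central = β-central ; β-⊕ʳ = β-⊕ʳ
    ; commute⇒β≡e = commute⇒β≡e ; β≡e⇒commute = β≡e⇒commute ; ·≡⊕ = ·≡⊕ }

-- Odd primes, and groups whose centre has prime order.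

prime-∤⇒coprime : ∀ {p n} → Prime p → ¬ (p ∣ n) → Coprime p n
prime-∤⇒coprime pp p∤n (d∣p , d∣n) with prime⇒irreducible pp d∣p
... | inj₁ d≡1  = d≡1
... | inj₂ refl = contradiction d∣n p∤n

odd-prime-half : ∀ {p} → Prime p → p ≢ 2 → ∃ λ h → h + h ≡ suc p
odd-prime-half {p} pp p≢2 with p % 2 in eq | m%n<n p 2
... | 0 | _ with prime⇒irreducible pp (m%n≡0⇒n∣m p 2 eq)
...   | inj₁ ()
...   | inj₂ 2≡p = contradiction (sym 2≡p) p≢2
-- Here p = 1 + 2 (p / 2), so (p + 1) / 2 is `suc (p / 2)`.
odd-prime-half {p} pp p≢2 | 1 | _ = suc (p / 2) , cong suc (begin
  p / 2 + suc (p / 2)     ≡⟨ +-comm (p / 2) (suc (p / 2)) ⟩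
  suc (p / 2 + p / 2)     ≡⟨ cong (λ k → suc (p / 2 + k)) (+-comm 0 (p / 2)) ⟩
  suc (2 * (p / 2))       ≡⟨ cong suc (*-comm 2 (p / 2)) ⟩
  1 + p / 2 * 2           ≡⟨ cong (_+ p / 2 * 2) eq ⟨
  p % 2 + p / 2 * 2       ≡⟨ m≡m%n+[m/n]*n p 2 ⟨
  p                       ∎)
  where open ≡-Reasoning
odd-prime-half pp p≢2 | suc (suc _) | s≤s (s≤s ())

module CentreOfOrderPrime (p : ℕ) (pp : Prime p) (G : FinGroup)
  (centre-size : centerSize G ≡ p) (exponent : ∀ g → pow G g (p * p) ≡ FinGroup.e G) where
  open FinGroup G
  open Powers G
  open Centre G
  open ≡-Reasoning

  coprime-orders : ∀ {m n} → Coprime m n → ∀ c → pow G c m ≡ e → pow G c n ≡ e → c ≡ e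
  coprime-orders {m} {n} m⊥n c cᵐ≡e cⁿ≡e =
    coprime-multiples group (_≡ e) (λ { refl x≡e → x≡e }) refl
      (λ { refl refl → identityˡ e }) (λ { refl → GroupProperties.ε⁻¹≈ε group })
      m⊥n c (trans (sym (pow≡⋆ c m)) cᵐ≡e) (trans (sym (pow≡⋆ c n)) cⁿ≡e)

  -- The order of `c` divides p², so the coprimality argument runs twice: first for the p-th power
  -- of `c`, whose p-th and d-th powers are trivial, then for `c` itself.
  torsion-free-below-p : ∀ {d} → 0 < d → d < p → ∀ c → pow G c d ≡ e → c ≡ e
  torsion-free-below-p {d} 0<d d<p c cᵈ≡e = coprime-orders p⊥d c cᵖ≡e cᵈ≡e
    where
    p⊥d : Coprime p d
    p⊥d = prime⇒coprime pp {{>-nonZero 0<d}} d<p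
    cᵖ≡e : pow G c p ≡ e
    cᵖ≡e = coprime-orders p⊥d (pow G c p) (trans (pow-* c p p) (exponent c)) (begin
      pow G (pow G c p) d ≡⟨ pow-* c d p ⟩
      pow G c (d * p)     ≡⟨ cong (pow G c) (*-comm d p) ⟩
      pow G c (p * d)     ≡⟨ pow-* c p d ⟨
      pow G (pow G c d) p ≡⟨ cong (λ u → pow G u p) cᵈ≡e ⟩
      pow G e p           ≡⟨ pow-e p ⟩
      e                   ∎)

  pow-collision : ∀ {c i j} → i < j → j ∸ i < p → pow G c i ≡ pow G c j → c ≡ e
  pow-collision {c} {i} {j} i<j d<p eq =
    torsion-free-below-p (m<n⇒0<n∸m i<j) d<p c (GroupProperties.∙-cancelˡ group (pow G c i) _ _ (begin
      pow G c i · pow G c (j ∸ i) ≡⟨ pow-+ c i (j ∸ i) ⟨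
      pow G c (i + (j ∸ i))       ≡⟨ cong (pow G c) (m+[n∸m]≡n (<⇒≤ i<j)) ⟩
      pow G c j                   ≡⟨ eq ⟨
      pow G c i                   ≡⟨ identityʳ _ ⟨
      pow G c i · e               ∎))

  pow-injective : ∀ {c} → c ≢ e → ∀ (i j : Fin p) → pow G c (toℕ i) ≡ pow G c (toℕ j) → i ≡ j
  pow-injective {c} c≢e i j eq with <-cmp (toℕ i) (toℕ j)
  ... | tri< i<j _ _ = contradiction (pow-collision i<j (≤-<-trans (m∸n≤m (toℕ j) (toℕ i)) (toℕ<n j)) eq) c≢e
  ... | tri≈ _ i≡j _ = toℕ-injective i≡j
  ... | tri> _ _ j<i = contradiction (pow-collision j<i (≤-<-trans (m∸n≤m (toℕ i) (toℕ j)) (toℕ<n i)) (sym eq)) c≢e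

  #central≡p : # (isCentral? G) ≡ p
  #central≡p = trans (sym (length-filter-tabulate (isCentral? G) (λ x → x))) centre-size

  -- The p powers of c are distinct and central, so they exhaust the centre.
  central⇒pow : ∀ {c w} → IsCentral G c → c ≢ e → IsCentral G w → ∃ λ (i : Fin p) → w ≡ pow G c (toℕ i)
  central⇒pow {c} {w} zc c≢e zw with any? (λ i → w ≟ pow G c (toℕ i))
  ... | yes found = found
  -- If `w` were missed, compare `hits` with `central`: the first is pointwise at most the second
  -- and both sum to `p`, so they agree everywhere, whereas at `w` they are 0 and 1.
  ... | no ¬found = contradiction (trans (sym hits-none) (trans (all-hit w) central-one)) λ ()
    where
    IsPow : El G → Fin p → Set
    IsPow x i = x ≡ pow G c (toℕ i)

    isPow? : ∀ x → Decidable (IsPow x)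
    isPow? x i = x ≟ pow G c (toℕ i)

    hits central : El G → ℕ
    hits x = # (isPow? x)
    central x = indicator (isCentral? G x)

    central-one : central w ≡ 1
    central-one with isCentral? G w
    ... | yes _ = refl
    ... | no ¬zw = contradiction zw ¬zw

    hits-none : hits w ≡ 0
    hits-none = #-none (isPow? w) λ i eq → ¬found (i , eq)

    hits≤central : ∀ x → hits x ≤ central x
    hits≤central x with any? (isPow? x) | isCentral? G x
    ... | no ¬any        | _      = subst (_≤ _) (sym (#-none (isPow? x) λ i eq → ¬any (i , eq))) z≤n
    ... | yes (i , eq)   | yes _  = ≤-reflexive (#-unique (isPow? x) i eq λ j eq′ → pow-injective c≢e j i (trans (sym eq′) eq))
    ... | yes (i , refl) | no ¬zx = contradiction (central-pow zc (toℕ i)) ¬zx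

    total : sum central ≡ sum hits
    total = begin
      # (isCentral? G)                  ≡⟨ #central≡p ⟩
      p                                 ≡⟨ *-identityʳ p ⟨
      p * 1                             ≡⟨ sum-const _ 1 (λ i → #-unique (λ x → isPow? x i) (pow G c (toℕ i)) refl (λ _ eq → eq)) ⟨
      sum (λ i → # (λ x → isPow? x i))  ≡⟨ ∑-comm (λ i x → indicator (isPow? x i)) ⟩
      sum hits                          ∎

    all-hit : ∀ x → hits x ≡ central x
    all-hit = sum-tight hits central hits≤central (≤-reflexive total)

  -- The p-th power of `c` is central, hence equals the i-th power of `c` for some i < p. If i were
  -- positive, the powers with exponents i and p would collide at a distance strictly between 0 and
  -- p; so i = 0.
  central-pow-p : ∀ {c} → IsCentral G c → pow G c p ≡ e
  central-pow-p {c} zc with c ≟ e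
  ... | yes refl = pow-e p
  ... | no c≢e with central⇒pow zc c≢e (central-pow zc p)
  ...   | i , cᵖ≡cⁱ with toℕ i in eq
  ...     | zero  = cᵖ≡cⁱ
  ...     | suc k = contradiction (pow-collision sk<p (∸-monoʳ-< {p} {suc k} {0} z<s (<⇒≤ sk<p)) (sym cᵖ≡cⁱ)) c≢e
    where
    sk<p : suc k < p
    sk<p = subst (_< p) eq (toℕ<n i)

-- Transversals of the centre, and multiples in the Baer group.

record CentralTransversal (G : FinGroup) (p : ℕ) : Set₁ where
  open FinGroup G
  field
    X               : El G → Set
    X?              : Decidable X
    meets-cosets    : ∀ x → ∃ λ z → IsCentral G z × X (z · x)
    meets-once      : ∀ {z x} → IsCentral G z → X x → X (z · x) → z ≡ e
    -- Both counts are stated as products, so that the sizes p^(2r) and p^(2r-1) follow by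
    -- cancelling `p` in the order of `G`.
    order≡p*#X      : order ≡ p * # X?
    order≡p*p*#X∩gX : ∀ {g} → ¬ IsCentral G g → order ≡ p * (p * # (λ x → X? x ×-dec X? (g · x)))

module Construction (p : ℕ) (pp : Prime p) (G : FinGroup)
  (centre-size : centerSize G ≡ p)
  (pow-central : ∀ x → IsCentral G (pow G x p))
  (exponent : ∀ g → pow G g (p * p) ≡ FinGroup.e G)
  (baerSum : BaerSum G)
  (a : El G) (aᵖ≢e : pow G a p ≢ FinGroup.e G) where

  open FinGroup G
  open Centre G
  open CentreOfOrderPrime p pp G centre-size exponent
  open BaerSum baerSum
  open AbelianGroupProperties abelianGroup using (inverseʳ-unique; ∙-cancelˡ; //-rightDividesˡ; //-rightDividesʳ; ⁻¹-∙-comm; x∙y⁻¹≈ε⇒x≈y; x≈y⇒x∙y⁻¹≈ε)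
  open CommutativeMonoidSolver (AbelianGroup.commutativeMonoid abelianGroup) using (solve; _⊜_) renaming (_⊕_ to _:+_)
  open ≡-Reasoning

  private instance
    p*p≢0 : NonZero (p * p)
    p*p≢0 = m*n≢0 p p {{prime⇒nonZero pp}} {{prime⇒nonZero pp}}

  Z : El G → Set
  Z = IsCentral G

  Z-⊕ : ∀ {x y} → Z x → Z y → Z (x ⊕ y)
  Z-⊕ zx zy = subst Z (sym (⊕-centralʳ zy _)) (central-· zx zy)

  ⋆-e : ∀ n → n ⋆ e ≡ e
  ⋆-e n = trans (sym (pow≡multiple e n)) (Powers.pow-e G n)

  p*p⋆ : ∀ x → (p * p) ⋆ x ≡ e
  p*p⋆ x = trans (sym (pow≡multiple x (p * p))) (exponent x)

  p⋆-central : ∀ x → Z (p ⋆ x)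
  p⋆-central x = subst Z (pow≡multiple x p) (pow-central x)

  central-p⋆ : ∀ {z} → Z z → p ⋆ z ≡ e
  central-p⋆ {z} zz = trans (sym (pow≡multiple z p)) (central-pow-p zz)

  -- This bounds the search for a multiplier, which makes membership in an enlarged subgroup
  -- decidable.
  ⋆-% : ∀ n x → n ⋆ x ≡ (n % (p * p)) ⋆ x
  ⋆-% n x = begin
    n ⋆ x                                          ≡⟨ cong (_⋆ x) (m≡m%n+[m/n]*n n (p * p)) ⟩
    (n % (p * p) + n / (p * p) * (p * p)) ⋆ x      ≡⟨ ⋆-+ x (n % (p * p)) _ ⟩
    (n % (p * p)) ⋆ x ⊕ (n / (p * p) * (p * p)) ⋆ x ≡⟨ cong ((n % (p * p)) ⋆ x ⊕_) (⋆-* x (n / (p * p)) (p * p)) ⟨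
    (n % (p * p)) ⋆ x ⊕ (n / (p * p)) ⋆ (p * p) ⋆ x ≡⟨ cong (λ u → (n % (p * p)) ⋆ x ⊕ (n / (p * p)) ⋆ u) (p*p⋆ x) ⟩
    (n % (p * p)) ⋆ x ⊕ (n / (p * p)) ⋆ e           ≡⟨ cong ((n % (p * p)) ⋆ x ⊕_) (⋆-e (n / (p * p))) ⟩
    (n % (p * p)) ⋆ x ⊕ e                           ≡⟨ ⊕-identityʳ _ ⟩
    (n % (p * p)) ⋆ x                               ∎

  x⊕pred⋆x≡e : ∀ x → x ⊕ pred (p * p) ⋆ x ≡ e
  x⊕pred⋆x≡e x = trans (cong (_⋆ x) (suc-pred (p * p))) (p*p⋆ x)

  -- A subgroup maximal among those meeting the centre trivially.

  record PartialComplement : Set₁ where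
    field
      K      : El G → Set
      K?     : Decidable K
      K-e    : K e
      K-⊕    : ∀ {x y} → K x → K y → K (x ⊕ y)
      K∩Z    : ∀ {x} → K x → Z x → x ≡ e

    K-⋆ : ∀ n {x} → K x → K (n ⋆ x)
    K-⋆ zero    Kx = K-e
    K-⋆ (suc n) Kx = K-⊕ Kx (K-⋆ n Kx)

    -- In exponent p² the inverse is the multiple by p² - 1, so closure under sums suffices.
    K-inv : ∀ {x} → K x → K (inv x)
    K-inv {x} Kx = subst K (inverseʳ-unique x _ (x⊕pred⋆x≡e x)) (K-⋆ (pred (p * p)) Kx)

    -- Adjoining w to K would create a nontrivial intersection with the centre.
    Obstructed : El G → Set
    Obstructed w = ∃ λ x → (Z x × x ≢ e) × ∃ λ n → K (x ⊕ n ⋆ w)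

  open PartialComplement

  trivial : PartialComplement
  trivial = record
    { K = _≡ e ; K? = _≟ e ; K-e = refl
    ; K-⊕ = λ { refl refl → ⊕-identityʳ e } ; K∩Z = λ x≡e _ → x≡e }

  module Adjoin (C : PartialComplement) (w : El G) where
    -- The subgroup generated by `K` and `w`. Putting the multiple of `w` on the side of `x` avoids
    -- naming an element of `K`; the sign is immaterial since n ranges over all residues modulo p².
    K+w : El G → Set
    K+w x = ∃ λ n → K C (x ⊕ n ⋆ w)

    K+w? : Decidable K+w
    K+w? x = map′ (λ (i , Ki) → toℕ i , Ki) reduce (any? λ (i : Fin (p * p)) → K? C (x ⊕ toℕ i ⋆ w))
      where
      reduce : K+w x → ∃ λ (i : Fin (p * p)) → K C (x ⊕ toℕ i ⋆ w)
      reduce (n , Kn) = fromℕ< (m%n<n n (p * p)) ,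
        subst (λ u → K C (x ⊕ u)) (trans (⋆-% n w) (cong (_⋆ w) (sym (toℕ-fromℕ< (m%n<n n (p * p)))))) Kn

    ⊆-K+w : ∀ {x} → K C x → K+w x
    ⊆-K+w {x} Kx = 0 , subst (K C) (sym (⊕-identityʳ x)) Kx

    K+w-w : K+w w
    K+w-w = pred (p * p) , subst (K C) (sym (x⊕pred⋆x≡e w)) (K-e C)

    K+w-⊕ : ∀ {x y} → K+w x → K+w y → K+w (x ⊕ y)
    K+w-⊕ {x} {y} (m , Km) (n , Kn) = m + n , subst (K C) (begin
      (x ⊕ m ⋆ w) ⊕ (y ⊕ n ⋆ w) ≡⟨ solve 4 (λ x u y v → (x :+ u) :+ (y :+ v) ⊜ (x :+ y) :+ (u :+ v)) refl x (m ⋆ w) y (n ⋆ w) ⟩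
      (x ⊕ y) ⊕ (m ⋆ w ⊕ n ⋆ w) ≡⟨ cong ((x ⊕ y) ⊕_) (⋆-+ w m n) ⟨
      (x ⊕ y) ⊕ (m + n) ⋆ w     ∎) (K-⊕ C Km Kn)

    adjoin : Σ PartialComplement λ C′ → (∀ {x} → K C x → K C′ x) × (K C′ w ⊎ Obstructed C′ w)
    adjoin with any? (λ x → (isCentral? G x ×-dec ¬? (x ≟ e)) ×-dec K+w? x)
    ... | yes obstruction = C , (λ Kx → Kx) , inj₂ obstruction
    ... | no ¬obstructed  = C′ , ⊆-K+w , inj₁ K+w-w
      where
      C′ : PartialComplement
      C′ = record
        { K = K+w ; K? = K+w? ; K-e = ⊆-K+w (K-e C) ; K-⊕ = K+w-⊕
        ; K∩Z = λ {x} Kx zx → decidable-stable (x ≟ e) λ x≢e → ¬obstructed (x , (zx , x≢e) , Kx) }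

  -- One pass over the list is enough: being in `K` and being obstructed both persist when `K`
  -- grows, so no element has to be revisited.
  adjoin-all : (ws : List (El G)) →
               Σ PartialComplement λ C → ∀ {w} → w ∈ₗ ws → K C w ⊎ Obstructed C w
  adjoin-all []       = trivial , λ ()
  adjoin-all (w ∷ ws) with adjoin-all ws
  ... | C , saturated with Adjoin.adjoin C w
  ...   | C′ , C⊆C′ , w-done = C′ , λ where
    (here refl) → w-done
    (there w∈)  → map-⊎ C⊆C′ (λ (x , zx , n , Kx+nv) → x , zx , n , C⊆C′ Kx+nv) (saturated w∈)

  abstract
    maximal : Σ PartialComplement λ C → ∀ w → K C w ⊎ Obstructed C w
    maximal with adjoin-all (allFin order)
    ... | C , saturated = C , λ w → saturated (∈-allFin w)

  open PartialComplement (proj₁ maximal) using () renaming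
    (K to L; K? to L?; K-e to L-e; K-⊕ to L-⊕; K∩Z to L∩Z; K-⋆ to L-⋆; K-inv to L-inv)

  -- If `w` is outside `L`, maximality gives a central x ≠ e with x ⊕ n w in `L`. When p divides n
  -- the term n w vanishes and x lies in `L`, which is impossible. Otherwise n w and p w = e both
  -- lie in the sum of `L` and the centre, and n is coprime to p.
  p⋆≡e⇒L⊕Z : ∀ w → p ⋆ w ≡ e → ∃ λ z → Z z × L (w ⊕ z)
  p⋆≡e⇒L⊕Z w pw≡e with proj₂ maximal w
  ... | inj₁ Lw = e , central-e , subst L (sym (⊕-identityʳ w)) Lw
  ... | inj₂ (x , (zx , x≢e) , n , Lx+nw) with p ∣? n
  ...   | yes (divides k refl) = contradiction (L∩Z (subst L nw-vanishes Lx+nw) zx) x≢e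
    where
    nw-vanishes : x ⊕ (k * p) ⋆ w ≡ x
    nw-vanishes = begin
      x ⊕ (k * p) ⋆ w ≡⟨ cong (x ⊕_) (⋆-* w k p) ⟨
      x ⊕ k ⋆ p ⋆ w   ≡⟨ cong (λ u → x ⊕ k ⋆ u) pw≡e ⟩
      x ⊕ k ⋆ e       ≡⟨ cong (x ⊕_) (⋆-e k) ⟩
      x ⊕ e           ≡⟨ ⊕-identityʳ x ⟩
      x               ∎
  ...   | no p∤n = coprime-multiples (AbelianGroup.group abelianGroup) H (subst H) He H-⊕ H-inv
                     (prime-∤⇒coprime pp p∤n) w (subst H (sym pw≡e) He) (x , zx , subst L (⊕-comm x _) Lx+nw)
    where
    H : El G → Set
    H y = ∃ λ z → Z z × L (y ⊕ z)
    He : H e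
    He = e , central-e , subst L (sym (⊕-identityʳ e)) L-e
    H-⊕ : ∀ {x y} → H x → H y → H (x ⊕ y)
    H-⊕ {x} {y} (u , zu , Lu) (v , zv , Lv) = u ⊕ v , Z-⊕ zu zv , subst L
      (solve 4 (λ x u y v → (x :+ u) :+ (y :+ v) ⊜ (x :+ y) :+ (u :+ v)) refl x u y v) (L-⊕ Lu Lv)
    H-inv : ∀ {x} → H x → H (inv x)
    H-inv {x} (u , zu , Lu) = inv u , central-inv zu , subst L (sym (⁻¹-∙-comm x u)) (L-inv Lu)

  -- The transversal: translates of `L` by multiples of `a`.

  private
    c : El G
    c = p ⋆ a

    c≢e : c ≢ e
    c≢e eq = aᵖ≢e (trans (pow≡multiple a p) eq)

  X : El G → Set
  X x = ∃ λ (i : Fin p) → L (x ⊕ toℕ i ⋆ a)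

  X? : Decidable X
  X? x = any? λ i → L? (x ⊕ toℕ i ⋆ a)

  p⋆[x⊕ia] : ∀ x i → p ⋆ (x ⊕ i ⋆ a) ≡ p ⋆ x ⊕ i ⋆ c
  p⋆[x⊕ia] x i = begin
    p ⋆ (x ⊕ i ⋆ a)     ≡⟨ ⋆-⊕ x (i ⋆ a) p ⟩
    p ⋆ x ⊕ p ⋆ i ⋆ a   ≡⟨ cong (p ⋆ x ⊕_) (⋆-* a p i) ⟩
    p ⋆ x ⊕ (p * i) ⋆ a ≡⟨ cong (λ k → p ⋆ x ⊕ k ⋆ a) (*-comm p i) ⟩
    p ⋆ x ⊕ (i * p) ⋆ a ≡⟨ cong (p ⋆ x ⊕_) (⋆-* a i p) ⟨
    p ⋆ x ⊕ i ⋆ c       ∎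

  abstract
    -- The element `c` generates the centre, which contains `p ⋆ x`; so i can be chosen with p (x ⊕
    -- i a) = p x ⊕ i c = e. Then x ⊕ i a lies in the sum of `L` and the centre.
    X-total : ∀ x → ∃ λ z → Z z × X (x ⊕ z)
    X-total x with central⇒pow (p⋆-central a) c≢e (central-inv (p⋆-central x))
    ... | i , inv-px≡ic with p⋆≡e⇒L⊕Z (x ⊕ toℕ i ⋆ a) p⋆≡e
      where
      p⋆≡e : p ⋆ (x ⊕ toℕ i ⋆ a) ≡ e
      p⋆≡e = begin
        p ⋆ (x ⊕ toℕ i ⋆ a)    ≡⟨ p⋆[x⊕ia] x (toℕ i) ⟩
        p ⋆ x ⊕ toℕ i ⋆ c      ≡⟨ cong (p ⋆ x ⊕_) (trans inv-px≡ic (pow≡multiple c (toℕ i))) ⟨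
        p ⋆ x ⊕ inv (p ⋆ x)    ≡⟨ ⊕-inverseʳ (p ⋆ x) ⟩
        e                      ∎
    ...   | z , zz , Lz = z , zz , i ,
      subst L (solve 3 (λ x y z → (x :+ y) :+ z ⊜ (x :+ z) :+ y) refl x (toℕ i ⋆ a) z) Lz

  -- Multiplication by p kills `L` and the centre, so both memberships determine the index through i
  -- c, and i = j. Then `z` is a difference of two elements of `L`.
  X-unique : ∀ {x z} → Z z → X x → X (x ⊕ z) → z ≡ e
  X-unique {x} {z} zz (i , Li) (j , Lj) = L∩Z Lz zz
    where
    p⋆L : ∀ {k} → L k → p ⋆ k ≡ e
    p⋆L {k} Lk = L∩Z (L-⋆ p Lk) (p⋆-central k)

    i≡j : i ≡ j
    i≡j = pow-injective c≢e i j (begin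
      pow G c (toℕ i) ≡⟨ pow≡multiple c (toℕ i) ⟩
      toℕ i ⋆ c       ≡⟨ ∙-cancelˡ (p ⋆ x) _ _ (begin
        p ⋆ x ⊕ toℕ i ⋆ c           ≡⟨ p⋆[x⊕ia] x (toℕ i) ⟨
        p ⋆ (x ⊕ toℕ i ⋆ a)         ≡⟨ p⋆L Li ⟩
        e                           ≡⟨ p⋆L Lj ⟨
        p ⋆ (x ⊕ z ⊕ toℕ j ⋆ a)     ≡⟨ p⋆[x⊕ia] (x ⊕ z) (toℕ j) ⟩
        p ⋆ (x ⊕ z) ⊕ toℕ j ⋆ c     ≡⟨ cong (_⊕ toℕ j ⋆ c) (⋆-⊕ x z p) ⟩
        p ⋆ x ⊕ p ⋆ z ⊕ toℕ j ⋆ c   ≡⟨ cong (λ u → p ⋆ x ⊕ u ⊕ toℕ j ⋆ c) (central-p⋆ zz) ⟩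
        p ⋆ x ⊕ e ⊕ toℕ j ⋆ c       ≡⟨ cong (_⊕ toℕ j ⋆ c) (⊕-identityʳ _) ⟩
        p ⋆ x ⊕ toℕ j ⋆ c           ∎) ⟩
      toℕ j ⋆ c       ≡⟨ pow≡multiple c (toℕ j) ⟨
      pow G c (toℕ j) ∎)

    Lz : L z
    Lz = subst L (begin
      (x ⊕ z ⊕ toℕ j ⋆ a) ⊕ inv (x ⊕ toℕ i ⋆ a) ≡⟨ cong (λ k → (x ⊕ z ⊕ toℕ j ⋆ a) ⊕ inv (x ⊕ toℕ k ⋆ a)) i≡j ⟩
      (x ⊕ z ⊕ toℕ j ⋆ a) ⊕ inv (x ⊕ toℕ j ⋆ a) ≡⟨ cong (_⊕ inv (x ⊕ toℕ j ⋆ a)) (solve 3 (λ x z y → (x :+ z) :+ y ⊜ z :+ (x :+ y)) refl x z (toℕ j ⋆ a)) ⟩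
      z ⊕ (x ⊕ toℕ j ⋆ a) ⊕ inv (x ⊕ toℕ j ⋆ a) ≡⟨ //-rightDividesʳ _ z ⟩
      z                                         ∎) (L-⊕ Lj (L-inv Li))

  central-·≡⊕ : ∀ {z} → Z z → ∀ x → z · x ≡ x ⊕ z
  central-·≡⊕ zz x = trans (zz x) (sym (⊕-centralʳ zz x))

  -- The central coordinate `φ`.

  φ : El G → El G
  φ x = proj₁ (X-total x)

  φ-central : ∀ x → Z (φ x)
  φ-central x = proj₁ (proj₂ (X-total x))

  X-φ : ∀ x → X (x ⊕ φ x)
  X-φ x = proj₂ (proj₂ (X-total x))

  φ-unique : ∀ {x z} → Z z → X (x ⊕ z) → φ x ≡ z
  φ-unique {x} {z} zz Xz = begin
    φ x               ≡⟨ ⊕-identityʳ _ ⟨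
    φ x ⊕ e           ≡⟨ cong (φ x ⊕_) (X-unique (Z-⊕ zz (central-inv (φ-central x))) (X-φ x) (subst X shift Xz)) ⟨
    φ x ⊕ (z ⊕ inv (φ x)) ≡⟨ solve 3 (λ f z g → f :+ (z :+ g) ⊜ z :+ (f :+ g)) refl (φ x) z (inv (φ x)) ⟩
    z ⊕ (φ x ⊕ inv (φ x)) ≡⟨ cong (z ⊕_) (⊕-inverseʳ (φ x)) ⟩
    z ⊕ e             ≡⟨ ⊕-identityʳ z ⟩
    z                 ∎
    where
    shift : x ⊕ z ≡ (x ⊕ φ x) ⊕ (z ⊕ inv (φ x))
    shift = begin
      x ⊕ z                           ≡⟨ ⊕-identityʳ _ ⟨
      x ⊕ z ⊕ e                       ≡⟨ cong (x ⊕ z ⊕_) (⊕-inverseʳ (φ x)) ⟨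
      x ⊕ z ⊕ (φ x ⊕ inv (φ x))       ≡⟨ solve 4 (λ x z f g → (x :+ z) :+ (f :+ g) ⊜ (x :+ f) :+ (z :+ g)) refl x z (φ x) (inv (φ x)) ⟩
      (x ⊕ φ x) ⊕ (z ⊕ inv (φ x))     ∎

  X⇒φ≡e : ∀ {x} → X x → φ x ≡ e
  X⇒φ≡e {x} Xx = φ-unique central-e (subst X (sym (⊕-identityʳ x)) Xx)

  φ≡e⇒X : ∀ {x} → φ x ≡ e → X x
  φ≡e⇒X {x} eq = subst X (trans (cong (x ⊕_) eq) (⊕-identityʳ x)) (X-φ x)

  φ-L : ∀ x {k} → L k → φ (x ⊕ k) ≡ φ x
  φ-L x {k} Lk with X-φ x
  ... | i , Li = φ-unique (φ-central x) (i , subst L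
    (solve 4 (λ x f y k → ((x :+ f) :+ y) :+ k ⊜ ((x :+ k) :+ f) :+ y) refl x (φ x) (toℕ i ⋆ a) k) (L-⊕ Li Lk))

  -- Stated for a subtracted `z` because `·≡⊕` presents g · x as g ⊕ x minus `β g x`.
  φ-Z : ∀ x {z} → Z z → φ (x ⊕ inv z) ≡ z ⊕ φ x
  φ-Z x {z} zz = φ-unique (Z-⊕ zz (φ-central x)) (subst X (sym (begin
    (x ⊕ inv z) ⊕ (z ⊕ φ x) ≡⟨ solve 4 (λ x w z f → (x :+ w) :+ (z :+ f) ⊜ (x :+ f) :+ (z :+ w)) refl x (inv z) z (φ x) ⟩
    (x ⊕ φ x) ⊕ (z ⊕ inv z) ≡⟨ cong ((x ⊕ φ x) ⊕_) (⊕-inverseʳ z) ⟩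
    (x ⊕ φ x) ⊕ e           ≡⟨ ⊕-identityʳ _ ⟩
    x ⊕ φ x                 ∎)) (X-φ x))

  φ-· : ∀ g x → φ (g · x) ≡ β g x ⊕ φ (g ⊕ x)
  φ-· g x = trans (cong φ (·≡⊕ g x)) (φ-Z (g ⊕ x) (β-central g x))

  -- The difference function `D` of an element `g`.

  module _ (g : El G) where
    D : El G → El G
    D x = φ (g · x) ⊕ inv (φ x)

    D-central : ∀ x → Z (D x)
    D-central x = Z-⊕ (φ-central (g · x)) (central-inv (φ-central x))

    D-unfold : ∀ x → D x ≡ β g x ⊕ φ (g ⊕ x) ⊕ inv (φ x)
    D-unfold x = cong (_⊕ inv (φ x)) (φ-· g x)

    -- A central factor passes through multiplication by `g` and shifts both values of `φ` equally,
    -- so `D` is constant on cosets of the centre.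
    D-Z : ∀ x {z} → Z z → D (x ⊕ inv z) ≡ D x
    D-Z x {z} zz = begin
      φ (g · (x ⊕ inv z)) ⊕ inv (φ (x ⊕ inv z))     ≡⟨ cong₂ (λ u v → φ u ⊕ inv v) g·-⊕ (φ-Z x zz) ⟩
      φ ((g · x) ⊕ inv z) ⊕ inv (z ⊕ φ x)           ≡⟨ cong₂ _⊕_ (φ-Z (g · x) zz) (sym (⁻¹-∙-comm z (φ x))) ⟩
      (z ⊕ φ (g · x)) ⊕ (inv z ⊕ inv (φ x))         ≡⟨ solve 4 (λ z f w i → (z :+ f) :+ (w :+ i) ⊜ (f :+ i) :+ (z :+ w)) refl z (φ (g · x)) (inv z) (inv (φ x)) ⟩
      D x ⊕ (z ⊕ inv z)                             ≡⟨ cong (D x ⊕_) (⊕-inverseʳ z) ⟩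
      D x ⊕ e                                       ≡⟨ ⊕-identityʳ _ ⟩
      D x                                           ∎
      where
      g·-⊕ : g · (x ⊕ inv z) ≡ (g · x) ⊕ inv z
      g·-⊕ = begin
        g · (x ⊕ inv z)   ≡⟨ cong (g ·_) (⊕-centralʳ (central-inv zz) x) ⟩
        g · (x · inv z)   ≡⟨ assoc g x (inv z) ⟨
        (g · x) · inv z   ≡⟨ ⊕-centralʳ (central-inv zz) (g · x) ⟨
        (g · x) ⊕ inv z   ∎

    D≡e⇒φ≡ : ∀ {x} → D x ≡ e → φ (g · x) ≡ φ x
    D≡e⇒φ≡ = x∙y⁻¹≈ε⇒x≈y _ _

    φ≡⇒D≡e : ∀ {x} → φ (g · x) ≡ φ x → D x ≡ e
    φ≡⇒D≡e = x≈y⇒x∙y⁻¹≈ε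

    -- Both values of `φ` ignore `L`, so only the bilinear term `β g x` notices the shift.
    D-shift-L : ∀ {k} → L k → ∀ x → D (x ⊕ k) ≡ β g k ⊕ D x
    D-shift-L {k} Lk x = begin
      D (x ⊕ k)                                       ≡⟨ D-unfold (x ⊕ k) ⟩
      β g (x ⊕ k) ⊕ φ (g ⊕ (x ⊕ k)) ⊕ inv (φ (x ⊕ k)) ≡⟨ cong₂ (λ u v → u ⊕ φ v ⊕ inv (φ (x ⊕ k))) (β-⊕ʳ g x k) (sym (⊕-assoc g x k)) ⟩
      (β g x ⊕ β g k) ⊕ φ ((g ⊕ x) ⊕ k) ⊕ inv (φ (x ⊕ k)) ≡⟨ cong₂ (λ u v → (β g x ⊕ β g k) ⊕ u ⊕ inv v) (φ-L (g ⊕ x) Lk) (φ-L x Lk) ⟩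
      (β g x ⊕ β g k) ⊕ φ (g ⊕ x) ⊕ inv (φ x)         ≡⟨ solve 4 (λ b d f i → ((b :+ d) :+ f) :+ i ⊜ d :+ ((b :+ f) :+ i)) refl (β g x) (β g k) (φ (g ⊕ x)) (inv (φ x)) ⟩
      β g k ⊕ (β g x ⊕ φ (g ⊕ x) ⊕ inv (φ x))         ≡⟨ cong (β g k ⊕_) (D-unfold x) ⟨
      β g k ⊕ D x                                     ∎

    module _ {z} (zz : Z z) (Lgz : L (g ⊕ z)) where
      -- Modulo `L` the element `g` is the inverse of `z`, and `φ` is invariant under `L`.
      φ-g⊕ : ∀ x → φ (g ⊕ x) ≡ z ⊕ φ x
      φ-g⊕ x = begin
        φ (g ⊕ x)                     ≡⟨ cong φ (//-rightDividesʳ z (g ⊕ x)) ⟨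
        φ ((g ⊕ x) ⊕ z ⊕ inv z)       ≡⟨ φ-Z _ zz ⟩
        z ⊕ φ ((g ⊕ x) ⊕ z)           ≡⟨ cong (λ u → z ⊕ φ u) (solve 3 (λ g x z → (g :+ x) :+ z ⊜ x :+ (g :+ z)) refl g x z) ⟩
        z ⊕ φ (x ⊕ (g ⊕ z))           ≡⟨ cong (z ⊕_) (φ-L x Lgz) ⟩
        z ⊕ φ x                       ∎

      D-affine : ∀ x → D x ≡ β g x ⊕ z
      D-affine x = begin
        D x                               ≡⟨ D-unfold x ⟩
        β g x ⊕ φ (g ⊕ x) ⊕ inv (φ x)     ≡⟨ cong (λ u → β g x ⊕ u ⊕ inv (φ x)) (φ-g⊕ x) ⟩
        β g x ⊕ (z ⊕ φ x) ⊕ inv (φ x)     ≡⟨ cong (_⊕ inv (φ x)) (⊕-assoc (β g x) z (φ x)) ⟨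
        β g x ⊕ z ⊕ φ x ⊕ inv (φ x)       ≡⟨ //-rightDividesʳ (φ x) _ ⟩
        β g x ⊕ z                         ∎

      D-shift : ∀ b x → D (x ⊕ b) ≡ β g b ⊕ D x
      D-shift b x = begin
        D (x ⊕ b)             ≡⟨ D-affine (x ⊕ b) ⟩
        β g (x ⊕ b) ⊕ z       ≡⟨ cong (_⊕ z) (β-⊕ʳ g x b) ⟩
        (β g x ⊕ β g b) ⊕ z   ≡⟨ solve 3 (λ x b z → (x :+ b) :+ z ⊜ b :+ (x :+ z)) refl (β g x) (β g b) z ⟩
        β g b ⊕ (β g x ⊕ z)   ≡⟨ cong (β g b ⊕_) (D-affine x) ⟨
        β g b ⊕ D x           ∎

    β-⋆ : ∀ n x → β g (n ⋆ x) ≡ n ⋆ β g x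
    β-⋆ zero    x = β-centralʳ central-e g
    β-⋆ (suc n) x = trans (β-⊕ʳ g x (n ⋆ x)) (cong (β g x ⊕_) (β-⋆ n x))

    β-expand : ∀ {x z} → Z z → ∀ n → β g (x ⊕ z ⊕ n ⋆ a) ≡ β g x ⊕ n ⋆ β g a
    β-expand {x} {z} zz n = begin
      β g (x ⊕ z ⊕ n ⋆ a)           ≡⟨ β-⊕ʳ g (x ⊕ z) (n ⋆ a) ⟩
      β g (x ⊕ z) ⊕ β g (n ⋆ a)     ≡⟨ cong₂ _⊕_ (β-⊕ʳ g x z) (β-⋆ n a) ⟩
      β g x ⊕ β g z ⊕ n ⋆ β g a     ≡⟨ cong (λ u → β g x ⊕ u ⊕ n ⋆ β g a) (β-centralʳ zz g) ⟩
      β g x ⊕ e ⊕ n ⋆ β g a         ≡⟨ cong (_⊕ n ⋆ β g a) (⊕-identityʳ _) ⟩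
      β g x ⊕ n ⋆ β g a             ∎

    -- Some g ⊕ φ(g) ⊕ i a lies in `L`. If i > 0, pairing it with `g` leaves i β(g,a) = e, because
    -- β(g,g) = e; hence β(g,a) = e as i < p. Since `L`, the centre and `a` generate the Baer group,
    -- `g` would then be central.
    centralising⇒L⊕Z : (∀ k → L k → β g k ≡ e) → ¬ Z g → ∃ λ z → Z z × L (g ⊕ z)
    centralising⇒L⊕Z g⊥L ¬zg with X-φ g
    ... | zero  , Lg = φ g , φ-central g , subst L (⊕-identityʳ _) Lg
    ... | suc i , Lg = contradiction (λ x → β≡e⇒commute (g⊥ x)) ¬zg
      where
      i′ : ℕ
      i′ = suc (toℕ i)

      g⊥a : β g a ≡ e
      g⊥a = torsion-free-below-p z<s (toℕ<n (suc i)) (β g a) (begin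
        pow G (β g a) i′           ≡⟨ pow≡multiple (β g a) i′ ⟩
        i′ ⋆ β g a                 ≡⟨ ⊕-identityˡ _ ⟨
        e ⊕ i′ ⋆ β g a             ≡⟨ cong (_⊕ i′ ⋆ β g a) (commute⇒β≡e {g} {g} refl) ⟨
        β g g ⊕ i′ ⋆ β g a         ≡⟨ β-expand (φ-central g) i′ ⟨
        β g (g ⊕ φ g ⊕ i′ ⋆ a)     ≡⟨ g⊥L _ Lg ⟩
        e                         ∎)

      g⊥ : ∀ x → β g x ≡ e
      g⊥ x with X-φ x
      ... | j , Lx = begin
        β g x                         ≡⟨ ⊕-identityʳ _ ⟨
        β g x ⊕ e                     ≡⟨ cong (β g x ⊕_) (trans (cong (toℕ j ⋆_) g⊥a) (⋆-e (toℕ j))) ⟨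
        β g x ⊕ toℕ j ⋆ β g a         ≡⟨ β-expand (φ-central x) (toℕ j) ⟨
        β g (x ⊕ φ x ⊕ toℕ j ⋆ a)     ≡⟨ g⊥L _ Lx ⟩
        e                             ∎

    D-equivariant : ¬ Z g → ∃ λ b → β g b ≢ e × (∀ x → D (x ⊕ b) ≡ β g b ⊕ D x)
    D-equivariant ¬zg with any? (λ k → L? k ×-dec ¬? (β g k ≟ e))
    ... | yes (k , Lk , βgk≢e) = k , βgk≢e , D-shift-L Lk
    -- Now `g` centralises `L`, so `D-affine` makes every `b` an admissible shift; one with
    -- `β g b ≢ e` exists because `g` is not central.
    ... | no none with centralising⇒L⊕Z (λ k Lk → decidable-stable (β g k ≟ e) λ βgk≢e → none (k , Lk , βgk≢e)) ¬zg
    ...   | z , zz , Lgz with any? (λ b → ¬? (β g b ≟ e))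
    ...     | yes (b , βgb≢e) = b , βgb≢e , D-shift zz Lgz b
    ...     | no all = contradiction
                (λ x → β≡e⇒commute (decidable-stable (β g x ≟ e) λ βgx≢e → all (x , βgx≢e))) ¬zg

  -- Equidistribution of central values, and the sizes of intersections.

  equidistribution : (f : El G → El G) → (∀ x → Z (f x)) → (b : El G) {c : El G} → Z c → c ≢ e →
                     (∀ x → f (x ⊕ b) ≡ c ⊕ f x) →
                     {P : El G → Set} (P? : Decidable P) →
                     (∀ x → P x → P (x ⊕ b)) → (∀ x → P (x ⊕ b) → P x) →
                     # P? ≡ p * # (λ x → P? x ×-dec (f x ≟ e))
  equidistribution f f-central b {c} zc c≢e f-shift {P} P? P⇒ P⇐ = begin
    # P?                              ≡⟨ #-partition P? (λ j → fibre? (toℕ j)) (λ _ _ → proj₁) locate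
                                          (λ i j x (_ , fx≡ic) (_ , fx≡jc) → pow-injective c≢e i j (power i j (trans (sym fx≡ic) fx≡jc))) ⟩
    sum (λ j → # (fibre? (toℕ {p} j)))    ≡⟨ sum-const {p} (λ j → # (fibre? (toℕ j))) _ (λ j → fibre-size (toℕ j)) ⟩
    -- The multiple `0 ⋆ c` is `e` by definition, so this fibre is the set in the claim.
    p * # (fibre? 0)                  ∎
    where
    fibre? : ∀ j → Decidable (λ x → P x × f x ≡ j ⋆ c)
    fibre? j x = P? x ×-dec (f x ≟ j ⋆ c)

    power : ∀ (i j : Fin p) → toℕ i ⋆ c ≡ toℕ j ⋆ c → pow G c (toℕ i) ≡ pow G c (toℕ j)
    power i j eq = trans (pow≡multiple c (toℕ i)) (trans eq (sym (pow≡multiple c (toℕ j))))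

    locate : ∀ x → P x → ∃ λ (j : Fin p) → P x × f x ≡ toℕ j ⋆ c
    locate x Px with central⇒pow zc c≢e (f-central x)
    ... | j , eq = j , Px , trans eq (pow≡multiple c (toℕ j))

    translation : Permutation′ order
    translation = permutation (_⊕ b) (_⊕ inv b) (//-rightDividesˡ b) (//-rightDividesʳ b)

    -- Translation by `b` carries the fibre of `f` over `j ⋆ c` onto the one over `suc j ⋆ c`.
    fibre-size : ∀ j → # (fibre? j) ≡ # (fibre? 0)
    fibre-size zero    = refl
    fibre-size (suc j) = trans
      (trans (#-permute (fibre? (suc j)) translation)
        (#-cong (fibre? (suc j) ∘ (_⊕ b)) (fibre? j)
          (λ x (Px , eq) → P⇐ x Px , ∙-cancelˡ c _ _ (trans (sym (f-shift x)) eq))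
          (λ x (Px , eq) → P⇒ x Px , trans (f-shift x) (cong (c ⊕_) eq))))
      (fibre-size j)

  -- X meets every coset of the centre once.
  #≡p*#∩X : {P : El G → Set} (P? : Decidable P) →
            (∀ {z} → Z z → ∀ x → P x → P (x ⊕ inv z)) →
            # P? ≡ p * # (λ x → P? x ×-dec X? x)
  #≡p*#∩X {P} P? P-Z = begin
    -- Translating by the inverse of `c` adds `c` to `φ`, and `X` is the zero set of `φ`.
    # P?                                   ≡⟨ equidistribution φ φ-central (inv c) (p⋆-central a) c≢e (λ x → φ-Z x (p⋆-central a)) P?
                                              (P-Z (p⋆-central a)) (λ x Px → subst P (//-rightDividesʳ (inv c) x) (P-Z (central-inv (p⋆-central a)) _ Px)) ⟩
    p * # (λ x → P? x ×-dec (φ x ≟ e))     ≡⟨ cong (p *_) (#-cong (λ x → P? x ×-dec (φ x ≟ e)) (λ x → P? x ×-dec X? x)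
                                              (λ _ (Px , eq) → Px , φ≡e⇒X eq) (λ _ (Px , Xx) → Px , X⇒φ≡e Xx)) ⟩
    p * # (λ x → P? x ×-dec X? x)          ∎

  private
    all? : Decidable {A = El G} (λ _ → ⊤)
    all? _ = yes tt

    order≡#all : order ≡ # all?
    order≡#all = trans (sym (*-identityʳ order)) (sym (sum-const {m = order} (λ _ → 1) 1 (λ _ → refl)))

  order≡p*#X : order ≡ p * # X?
  order≡p*#X = begin
    order                            ≡⟨ order≡#all ⟩
    # all?                           ≡⟨ #≡p*#∩X all? (λ _ _ _ → tt) ⟩
    p * # (λ x → all? x ×-dec X? x)  ≡⟨ cong (p *_) (#-cong (λ x → all? x ×-dec X? x) X? (λ _ → proj₂) (λ _ Xx → tt , Xx)) ⟩
    p * # X?                         ∎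

  -- One factor `p` comes from the equidistribution of `D` on `G`, the other from cutting its zero
  -- set, a union of cosets of the centre, down to `X`. On `X` the value of `φ` is `e`, so there `D`
  -- vanishes exactly when g · x lies in `X`.
  order≡p*p*#X∩gX : ∀ {g} → ¬ Z g → order ≡ p * (p * # (λ x → X? x ×-dec X? (g · x)))
  order≡p*p*#X∩gX {g} ¬zg with D-equivariant g ¬zg
  ... | b , βgb≢e , D-shift-b = begin
    order                                  ≡⟨ order≡#all ⟩
    # all?                                 ≡⟨ equidistribution (D g) (D-central g) b (β-central g b) βgb≢e D-shift-b all? _ _ ⟩
    p * # D≡e?                             ≡⟨ cong (p *_) (#≡p*#∩X D≡e? (λ zz x (_ , Dx≡e) → tt , trans (D-Z g x zz) Dx≡e)) ⟩
    p * (p * # (λ x → D≡e? x ×-dec X? x))  ≡⟨ cong (λ k → p * (p * k)) (#-cong (λ x → D≡e? x ×-dec X? x) (λ x → X? x ×-dec X? (g · x))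
                                               (λ x ((_ , Dx≡e) , Xx) → Xx , φ≡e⇒X (trans (D≡e⇒φ≡ g Dx≡e) (X⇒φ≡e Xx)))
                                               (λ x (Xx , Xgx) → (tt , φ≡⇒D≡e g (trans (X⇒φ≡e Xgx) (sym (X⇒φ≡e Xx)))) , Xx)) ⟩
    p * (p * # (λ x → X? x ×-dec X? (g · x))) ∎
    where
    D≡e? : Decidable (λ x → ⊤ × D g x ≡ e)
    D≡e? x = all? x ×-dec (D g x ≟ e)

  transversal : CentralTransversal G p
  transversal = record
    { X = X ; X? = X?
    ; meets-cosets = λ x → φ x , φ-central x , subst X (sym (central-·≡⊕ (φ-central x) x)) (X-φ x)
    ; meets-once = λ {z} {x} zz Xx Xzx → X-unique zz Xx (subst X (central-·≡⊕ zz x) Xzx)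
    ; order≡p*#X = order≡p*#X
    ; order≡p*p*#X∩gX = order≡p*p*#X∩gX }

-- Coefficients in the group ring.

module Coefficients (G : FinGroup) where
  open FinGroup G
  open +-*-Solver using (solve; con; _:=_; _:+_; _:*_)
  open ≡-Reasoning

  -- For fixed `y` the equation forces x = g · y, so after exchanging the sums each `y` in `S`
  -- contributes 1 exactly when g · y is in `S`.
  prodCoeff≡#∩ : (S : Subset order) (g : El G) →
                 prodCoeff G S g ≡ # (λ y → (y ∈? S) ×-dec (g · y ∈? S))
  prodCoeff≡#∩ S g = begin
    prodCoeff G S g                             ≡⟨ length-filter-cartesianProduct {m = order} {n = order} _ (λ x → x) (λ y → y) ⟩
    sum (λ x → # λ y → quotient? x y)           ≡⟨ ∑-comm (λ x y → indicator (quotient? x y)) ⟩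
    sum (λ y → # λ x → quotient? x y)           ≡⟨ sum-cong-≗ count-dividends ⟩
    # (λ y → (y ∈? S) ×-dec (g · y ∈? S))       ∎
    where
    quotient? : ∀ x y → Dec (x ∈ S × y ∈ S × x · inv y ≡ g)
    quotient? x y = (x ∈? S) ×-dec ((y ∈? S) ×-dec ((x · inv y) ≟ g))

    open GroupProperties (Powers.group G) using (//-rightDividesˡ; //-rightDividesʳ)

    dividend : ∀ {x y} → x · inv y ≡ g → x ≡ g · y
    dividend {x} {y} eq = trans (sym (//-rightDividesˡ y x)) (cong (_· y) eq)

    count-dividends : ∀ y → # (λ x → quotient? x y) ≡ indicator ((y ∈? S) ×-dec (g · y ∈? S))
    count-dividends y with (y ∈? S) ×-dec (g · y ∈? S)
    ... | yes (y∈S , gy∈S) = #-unique (λ x → quotient? x y) (g · y) (gy∈S , y∈S , //-rightDividesʳ y g)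
                               λ x (_ , _ , eq) → dividend eq
    ... | no ¬both = #-none (λ x → quotient? x y)
                       λ x (x∈S , y∈S , eq) → ¬both (y∈S , subst (_∈ S) (dividend eq) x∈S)

  coefficients : (f : El G → ℕ) (N : Subset order) → e ∈ N → ∀ {k l} →
                 f e ≡ k → (∀ {g} → g ≢ e → g ∈ N → f g ≡ 0) → (∀ {g} → ¬ (g ∈ N) → f g ≡ l) →
                 ∀ g → f g ≡ k * δ G g e + l * notIn G g N
  coefficients f N e∈N {k} {l} fe≡k f≡0 f≡l g with g ≟ e | g ∈? N
  ... | yes refl | yes _  = trans fe≡k (solve 2 (λ k l → k := k :* con 1 :+ l :* con 0) refl k l)
  ... | yes refl | no e∉N = contradiction e∈N e∉N
  ... | no g≢e | yes g∈N  = trans (f≡0 g≢e g∈N) (solve 2 (λ k l → con 0 := k :* con 0 :+ l :* con 0) refl k l)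
  ... | no _   | no g∉N   = trans (f≡l g∉N) (solve 2 (λ k l → l := k :* con 0 :+ l :* con 1) refl k l)

-- The relative difference set.

abstract
  centralTransversal : ∀ p → Prime p → p ≢ 2 → (G : FinGroup) → ∀ r →
                       IsExtraspecialOfOrder G p r → HasExponentSq G p → CentralTransversal G p
  centralTransversal p pp p≢2 G r (_ , centre-size , comm-central , pow-central) (exponent , a , aᵖ≢e)
    with odd-prime-half pp p≢2
  ... | h , 2h≡1+p =
    Construction.transversal p pp G centre-size pow-central exponent (Baer.baerSum G comm-central h half) a aᵖ≢e
    where
    open FinGroup G
    open CentreOfOrderPrime p pp G centre-size exponent using (central-pow-p)
    open ≡-Reasoning

    half : ∀ x y → pow G (comm G x y) (h + h) ≡ comm G x y
    half x y = begin
      pow G κ (h + h)  ≡⟨ cong (pow G κ) 2h≡1+p ⟩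
      -- Commutators lie in the centre, so their p-th powers are trivial.
      κ · pow G κ p    ≡⟨ cong (κ ·_) (central-pow-p (comm-central x y)) ⟩
      κ · e            ≡⟨ identityʳ κ ⟩
      κ                ∎
      where
      κ : El G
      κ = comm G x y

theorem1p2 : (p r : ℕ) → Prime p → p ≢ 2 → 1 ≤ r →
    (G : FinGroup) → IsExtraspecialOfOrder G p r → HasExponentSq G p →
    Σ (Subset (FinGroup.order G)) λ X → Σ (Subset (FinGroup.order G)) λ N →
    IsRDS G X N (p ^ (2 * r)) p (p ^ (2 * r)) (p ^ (2 * r ∸ 1)) × IsSemiregular G X N
theorem1p2 p r@(suc _) pp p≢2 _ G extraspecial@(order≡ , centre-size , _) exponentSq@(exponent , _) =
  S , N , (N-subgroup , ∣N∣*m≡order , ∣N∣≡p , trans ∣S∣≡#X #X≡p²ʳ , m^n>0 p (2 * r ∸ 1) , coefficient) , semiregular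
  where
  open FinGroup G
  open Centre G
  open Coefficients G
  open CentreOfOrderPrime p pp G centre-size exponent using (#central≡p)
  open CentralTransversal (centralTransversal p pp p≢2 G r extraspecial exponentSq)

  instance
    p≢0 : NonZero p
    p≢0 = prime⇒nonZero pp

  S N : Subset order
  S = subset X?
  N = subset (isCentral? G)

  N⁺ : ∀ {x} → IsCentral G x → x ∈ N
  N⁺ = ∈-subset⁺ (isCentral? G)

  N⁻ : ∀ {x} → x ∈ N → IsCentral G x
  N⁻ = ∈-subset⁻ (isCentral? G)

  S⁺ : ∀ {x} → X x → x ∈ S
  S⁺ = ∈-subset⁺ X?

  S⁻ : ∀ {x} → x ∈ S → X x
  S⁻ = ∈-subset⁻ X?

  N-subgroup : IsSubgroup G N
  N-subgroup = N⁺ central-e , (λ x y x∈N y∈N → N⁺ (central-· (N⁻ x∈N) (N⁻ y∈N))) , λ x x∈N → N⁺ (central-inv (N⁻ x∈N))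

  order≡p*p²ʳ : order ≡ p * p ^ (2 * r)
  order≡p*p²ʳ = trans order≡ (cong (p ^_) (+-comm (2 * r) 1))

  ∣N∣≡p : ∣ N ∣ ≡ p
  ∣N∣≡p = trans (∣subset∣ (isCentral? G)) #central≡p

  ∣N∣*m≡order : ∣ N ∣ * p ^ (2 * r) ≡ order
  ∣N∣*m≡order = trans (cong (_* p ^ (2 * r)) ∣N∣≡p) (sym order≡p*p²ʳ)

  ∣S∣≡#X : ∣ S ∣ ≡ # X?
  ∣S∣≡#X = ∣subset∣ X?

  #X≡p²ʳ : # X? ≡ p ^ (2 * r)
  #X≡p²ʳ = *-cancelˡ-≡ _ _ p (trans (sym order≡p*#X) order≡p*p²ʳ)

  X∩gX? : ∀ g → Decidable (λ x → X x × X (g · x))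
  X∩gX? g x = X? x ×-dec X? (g · x)

  #X∩gX≡p²ʳ⁻¹ : ∀ {g} → ¬ IsCentral G g → # (X∩gX? g) ≡ p ^ (2 * r ∸ 1)
  -- As `r` is a successor, `p ^ (2 * r)` unfolds to `p * p ^ (2 * r ∸ 1)`, and `p` cancels twice.
  #X∩gX≡p²ʳ⁻¹ ¬zg = *-cancelˡ-≡ _ _ p (*-cancelˡ-≡ _ _ p (trans (sym (order≡p*p*#X∩gX ¬zg)) order≡p*p²ʳ))

  prodCoeff≡#X∩gX : ∀ g → prodCoeff G S g ≡ # (X∩gX? g)
  prodCoeff≡#X∩gX g = trans (prodCoeff≡#∩ S g) (#-cong (λ y → (y ∈? S) ×-dec (g · y ∈? S)) (X∩gX? g)
    (λ _ (y∈S , gy∈S) → S⁻ y∈S , S⁻ gy∈S) (λ _ (Xy , Xgy) → S⁺ Xy , S⁺ Xgy))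

  #X∩eX≡p²ʳ : # (X∩gX? e) ≡ p ^ (2 * r)
  #X∩eX≡p²ʳ = trans (#-cong (X∩gX? e) X? (λ _ → proj₁) (λ x Xx → Xx , subst X (sym (identityˡ x)) Xx)) #X≡p²ʳ

  coefficient : ∀ g → prodCoeff G S g ≡ p ^ (2 * r) * δ G g e + p ^ (2 * r ∸ 1) * notIn G g N
  coefficient = coefficients (prodCoeff G S) N (N⁺ central-e)
    (trans (prodCoeff≡#X∩gX e) #X∩eX≡p²ʳ)
    -- For central `g`, the elements x and g · x lie in one coset of the centre, which meets `X`
    -- once.
    (λ {g} g≢e g∈N → trans (prodCoeff≡#X∩gX g) (#-none (X∩gX? g) λ x (Xx , Xgx) → g≢e (meets-once (N⁻ g∈N) Xx Xgx)))
    (λ {g} g∉N → trans (prodCoeff≡#X∩gX g) (#X∩gX≡p²ʳ⁻¹ (g∉N ∘ N⁺)))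

  coset? : ∀ g → Decidable (λ x → x ∈ S × ∃ λ h → h ∈ N × x ≡ h · g)
  coset? g x = (x ∈? S) ×-dec any? (λ h → (h ∈? N) ×-dec (x ≟ (h · g)))

  semiregular : IsSemiregular G S N
  semiregular g = trans (length-filter-tabulate (coset? g) (λ x → x)) (#-unique (coset? g) (z · g) (S⁺ Xzg , z , N⁺ zz , refl)
    -- Write h · g as (h · inv z) · (z · g): both z · g and this element lie in `X`, so the central
    -- factor h · inv z is `e`.
    λ { _ (x∈S , h , h∈N , refl) → cong (_· g) (x∙y⁻¹≈ε⇒x≈y h z
          (meets-once (central-· (N⁻ h∈N) (central-inv zz)) Xzg (subst X (sym (rebase h)) (S⁻ x∈S)))) })
    where
    open GroupProperties (Powers.group G) using (x∙y⁻¹≈ε⇒x≈y; \\-leftDividesʳ)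

    z : El G
    z = proj₁ (meets-cosets g)

    zz : IsCentral G z
    zz = proj₁ (proj₂ (meets-cosets g))

    Xzg : X (z · g)
    Xzg = proj₂ (proj₂ (meets-cosets g))

    rebase : ∀ h → (h · inv z) · (z · g) ≡ h · g
    rebase h = trans (assoc h (inv z) (z · g)) (cong (h ·_) (\\-leftDividesʳ z g))
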